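{- There exists an absolute constant $c$ with $0<c<1$ such that $$\limsup_{x\rightarrow\infty}\frac{T_c(x)}{\pi(x)}<\frac12,$$ where $T_c(x)=\#\{p\le x: p \text{ prime},\ P^+(p-1)\ge p^c\}$.
   Context: For an integer $n\ge 2$, $P^+(n)$ denotes the largest prime factor of $n$, and by convention $P^+(1)=1$. For real $x$, $\pi(x)$ denotes the number of primes $p\le x$. For a real number $c$ with $0<c<1$ and real $x$, $T_c(x)$ denotes the number of primes $p\le x$ such that $P^+(p-1)\ge p^c$. The limit superior is taken as the real variable $x$ tends to infinity. -}

module Defs where

open import Data.Integer.Base using (+_)
open import Data.List.Base using (List; length; foldr)
open import Data.List.Membership.Propositional using (_∈_)
open import Data.List.Relation.Unary.Unique.Propositional using (Unique)
open import Data.Nat.Base as ℕ using (ℕ; zero; suc; NonZero)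
open import Data.Nat.Primality using (Prime)
open import Data.Nat.Primality.Factorisation using (factorise; factors)
open import Data.Product.Base using (Σ-syntax; ∃; ∃-syntax; _×_; _,_)
open import Data.Rational.Base as ℚ using (ℚ; 1ℚ; _/_)
import Data.Rational.Properties as ℚ
open import Data.Sum.Base using (_⊎_; inj₁; inj₂)
open import Function.Bundles using (_⇔_)
open import Relation.Binary.Definitions using (tri<; tri≈; tri>)
open import Relation.Binary.PropositionalEquality using (_≡_; refl; subst)
open import Relation.Nullary using (¬_)

-- Real numbers as two-sided (located) Dedekind cuts: L q means q < x and
-- U q means x < q.

record ℝ : Set₁ where
  field
    L U         : ℚ → Set
    L-inhabited : ∃[ q ] L q
    U-inhabited : ∃[ q ] U q
    L-down      : ∀ {q r} → q ℚ.< r → L r → L q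
    U-up        : ∀ {q r} → q ℚ.< r → U q → U r
    L-open      : ∀ {q} → L q → ∃[ r ] (q ℚ.< r × L r)
    U-open      : ∀ {r} → U r → ∃[ q ] (q ℚ.< r × U q)
    disjoint    : ∀ {q} → L q → ¬ U q
    located     : ∀ {q r} → q ℚ.< r → L q ⊎ U r

open ℝ

infix 4 _<_ _≤_

_<_ : ℝ → ℝ → Set
x < y = ∃[ q ] (U x q × L y q)

_≤_ : ℝ → ℝ → Set
x ≤ y = ¬ (y < x)

private
  -1+<  : ∀ q → q ℚ.- 1ℚ ℚ.< q
  -1+< q = subst (q ℚ.- 1ℚ ℚ.<_) (ℚ.+-identityʳ q)
    (ℚ.+-monoʳ-< q (ℚ.negative⁻¹ (ℚ.- 1ℚ)))

  <+1 : ∀ q → q ℚ.< q ℚ.+ 1ℚ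
  <+1 q = subst (ℚ._< q ℚ.+ 1ℚ) (ℚ.+-identityʳ q)
    (ℚ.+-monoʳ-< q (ℚ.positive⁻¹ 1ℚ))

  locate : ∀ p {q r} → q ℚ.< r → q ℚ.< p ⊎ p ℚ.< r
  locate p {q} q<r with ℚ.<-cmp q p
  ... | tri< q<p _ _  = inj₁ q<p
  ... | tri≈ _ refl _ = inj₂ q<r
  ... | tri> _ _ p<q  = inj₂ (ℚ.<-trans p<q q<r)

fromℚ : ℚ → ℝ
fromℚ p = record
  { L           = ℚ._< p
  ; U           = p ℚ.<_
  ; L-inhabited = p ℚ.- 1ℚ , -1+< p
  ; U-inhabited = p ℚ.+ 1ℚ , <+1 p
  ; L-down      = ℚ.<-trans
  ; U-up        = λ q<r p<q → ℚ.<-trans p<q q<r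
  ; L-open      = λ q<p → let m , q<m , m<p = ℚ.<-dense q<p in m , q<m , m<p
  ; U-open      = λ p<r → let m , p<m , m<r = ℚ.<-dense p<r in m , m<r , p<m
  ; disjoint    = ℚ.<-asym
  ; located     = locate p
  }

fromℕ : ℕ → ℝ
fromℕ n = fromℚ (+ n / 1)

-- p ^ c ≤ m for p ≥ 1 and real c > 0, where p ^ c is the supremum of the
-- powers p ^ (a / b) over rationals 0 ≤ a / b < c, and p ^ (a / b) is the
-- b-th root of p ^ a: m is an upper bound of all these powers.

_^_≤ℕ_ : ℕ → ℝ → ℕ → Set
p ^ c ≤ℕ m =
  ∀ a b .{{_ : NonZero b}} → fromℚ (+ a / b) < c → p ℕ.^ a ℕ.≤ m ℕ.^ b

-- The empty factorisation of 1 gives P⁺ 1 = 1.  The value at 0 is arbitrary.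

P⁺ : ℕ → ℕ
P⁺ zero      = 1
P⁺ n@(suc _) = foldr ℕ._⊔_ 1 (factors (factorise n))

-- "The set { n | A n } has exactly k elements".  Cardinalities are relations
-- rather than functions because p ≤ x and p ^ c ≤ℕ m are not decidable for
-- arbitrary real x and c.  Classically, the sets counted below, being bounded
-- by x, have exactly one cardinality each.

HasCardinality : (ℕ → Set) → ℕ → Set
HasCardinality A k =
  Σ[ ns ∈ List ℕ ] (Unique ns × (∀ n → n ∈ ns ⇔ A n) × length ns ≡ k)

π[_]≡_ : ℝ → ℕ → Set
π[ x ]≡ k = HasCardinality (λ p → Prime p × fromℕ p ≤ x) k

T[_,_]≡_ : ℝ → ℝ → ℕ → Set
T[ c , x ]≡ k =
  HasCardinality (λ p → Prime p × fromℕ p ≤ x × p ^ c ≤ℕ P⁺ (p ℕ.∸ 1)) k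

-- The graph of x ↦ T_c(x) / π(x), defined where π(x) ≠ 0, that is for x ≥ 2.

T/π : ℝ → ℝ → ℚ → Set
T/π c x y = ∃[ t ] ∃[ n ] (T[ c , x ]≡ t × π[ x ]≡ n ×
  Σ[ n≢0 ∈ NonZero n ] y ≡ _/_ (+ t) n {{n≢0}})

-- F is the graph of a function of a real variable.  Since
-- limsup F = inf_X sup_{x ≥ X} F x, it is below r iff for some X the supremum
-- over x ≥ X is at most some s < r.  A real number equal to the limsup need
-- not exist constructively.

limsup_<_ : (ℝ → ℚ → Set) → ℝ → Set₁
limsup F < r =
  ∃[ s ] (s < r × (∃[ X ] (∀ x → X ≤ x → ∀ y → F x y → fromℚ y ≤ s)))

{-# OPTIONS --safe #-}
module Submission where

-- If p - 1 = m q with q = P⁺(p - 1) ≥ p^c and p ≤ N, then m ≤ y = N^(1-c), so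
-- p - 1 has no prime factor in (y, A] and p has none up to A, where A is a
-- small fixed power of N.  The number of such p is bounded by Selberg's sieve
-- in its dual form: to every pair i = (a, b) with a ≤ A squarefree and b ∤ a a
-- prime in (y, A] belongs a periodic function φᵢ which equals 1 on the sifted
-- set, and these functions are almost orthogonal on [0, N).  Hence the count is
-- O(N / G) with G = ∑ 1/(a b) ≫ log N · ∑_{y<b≤A} 1/b, and the sum over b tends
-- to infinity as c → 1 by Chebyshev's bounds.  Comparing with π(N) ≫ N / log N,
-- the ratio is as small as we like for c close to 1.

open import Data.Integer.Base as ℤ using (ℤ; -[1+_]; 0ℤ; 1ℤ; +≤+; -≤+)
import Data.Integer.Properties as ℤₚ
import Data.Integer.Tactic.RingSolver as ℤ-Ring
open import Data.List.Base using (List; []; _∷_; _++_; length; map; filter; foldr; upTo; applyDownFrom; cartesianProductWith)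
open import Data.List.Membership.Propositional using (_∈_; find; lose)
open import Data.List.Membership.Propositional.Properties
  using (∈-∃++; ∈-++⁻; ∈-++⁺ˡ; ∈-++⁺ʳ; ∈-map⁺; ∈-filter⁺; ∈-filter⁻; ∈-upTo⁺; ∈-upTo⁻;
         ∈-applyDownFrom⁺; ∈-applyDownFrom⁻; ∈-cartesianProductWith⁺; ∈-cartesianProductWith⁻)
open import Data.List.Properties using (length-++; length-filter; length-map; length-upTo)
open import Data.List.Relation.Unary.All as All using (All; []; _∷_)
open import Data.List.Relation.Unary.All.Properties using (All¬⇒¬Any)
open import Data.List.Relation.Unary.AllPairs using (AllPairs; []; _∷_)
open import Data.List.Relation.Unary.Any using (here; there; any?)
open import Data.List.Relation.Unary.Unique.Propositional using (Unique)
import Data.List.Relation.Unary.Unique.Propositional.Properties as Unique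
open import Data.Nat.Base as ℕ using (ℕ; zero; suc; 2+; NonZero; z≤n; s≤s)
open import Data.Nat.Coprimality using (Coprime; coprime-Bézout; coprime-divisor)
open import Data.Nat.Divisibility
open import Data.Nat.GCD using (module Bézout)
open import Data.Nat.Induction using (<-rec)
open import Data.Nat.ListAction using (product)
open import Data.Nat.ListAction.Properties using (∈⇒∣product)
open import Data.Nat.Primality using (Prime; prime?; ¬prime[1]; euclidsLemma; prime⇒irreducible; prime⇒nonZero; prime⇒nonTrivial)
open import Data.Nat.Primality.Factorisation using (factorise; factorisationHasAllPrimeFactors; module PrimeFactorisation)
import Data.Nat.Properties as ℕₚ
import Data.Nat.Tactic.RingSolver as ℕ-Ring
open import Data.Product.Base using (∃-syntax; _×_; _,_; proj₁; proj₂)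
open import Data.Rational.Base using (0ℚ; 1ℚ; ½)
open import Data.Sum.Base using (_⊎_; inj₁; inj₂; map₂)
open import Function.Base using (_∘_)
open import Function.Bundles using (Equivalence)
open import Relation.Binary.PropositionalEquality
open import Relation.Nullary using (¬_; Dec; yes; no; contradiction)
open import Relation.Nullary.Decidable using (¬?; _×-dec_; decidable-stable)

-- Every step loses an absolute constant: the sieve, Chebyshev's lower bound, the sums of
-- reciprocals. Sieving `p` alone would give only O(π(N)), so a factor that can be made arbitrarily
-- large must come from the condition on `p - 1`. A single prime `b` per pair supplies it: with log
-- A = 2^ρ log y, the sum of 1/b over (y, A] is at least ρ / 112, and a large `ρ` outweighs all the
-- constants. This is what forces `c` so close to 1. Orthogonality is decided at one prime. Distinct
-- pairs behave differently at some prime, where the product of the two local factors has mean zero;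
-- by the Chinese remainder theorem the whole product then sums to 0 over a period, and only an
-- incomplete period is left. Its contribution is bounded by a power of `A`, harmless once `A` is at
-- most N^(1/16). Everything is done in integers: 1/n becomes `A ! / n`, and the factor `(A !)²`
-- cancels at the end.

-- Finite sums and the quadratic form behind the sieve.

module Sums where

  open import Data.Integer.Base using (+_; _+_; _*_; _-_; -_; _≤_; ∣_∣)
  open ℤ-Ring using (solve-∀)

  ∑< : ℕ → (ℕ → ℤ) → ℤ
  ∑< zero    f = 0ℤ
  ∑< (suc n) f = ∑< n f + f n

  ∑<-cong : ∀ n {f g} → (∀ k → k ℕ.< n → f k ≡ g k) → ∑< n f ≡ ∑< n g
  ∑<-cong zero    eq = refl
  ∑<-cong (suc n) eq =
    cong₂ _+_ (∑<-cong n (λ k k<n → eq k (ℕₚ.m<n⇒m<1+n k<n))) (eq n (ℕₚ.n<1+n n))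

  ∑<-0 : ∀ n → ∑< n (λ _ → 0ℤ) ≡ 0ℤ
  ∑<-0 zero    = refl
  ∑<-0 (suc n) = trans (ℤₚ.+-identityʳ _) (∑<-0 n)

  ∑<-const : ∀ n c → ∑< n (λ _ → c) ≡ + n * c
  ∑<-const zero    c = refl
  ∑<-const (suc n) c = trans (cong (_+ c) (∑<-const n c))
    (trans (identity (+ n) c) (cong (_* c) (sym (ℤₚ.pos-+ 1 n))))
    where
    identity : ∀ n c → n * c + c ≡ (1ℤ + n) * c
    identity = solve-∀

  ∑<-+ : ∀ n f g → ∑< n (λ k → f k + g k) ≡ ∑< n f + ∑< n g
  ∑<-+ zero    f g = refl
  ∑<-+ (suc n) f g = trans (cong (_+ (f n + g n)) (∑<-+ n f g))
    (identity (∑< n f) (∑< n g) (f n) (g n))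
    where
    identity : ∀ a b c d → (a + b) + (c + d) ≡ (a + c) + (b + d)
    identity = solve-∀

  ∑<-*ˡ : ∀ n c f → ∑< n (λ k → c * f k) ≡ c * ∑< n f
  ∑<-*ˡ zero    c f = sym (ℤₚ.*-zeroʳ c)
  ∑<-*ˡ (suc n) c f = trans (cong (_+ c * f n) (∑<-*ˡ n c f))
    (sym (ℤₚ.*-distribˡ-+ c (∑< n f) (f n)))

  ∑<-++ : ∀ m n f → ∑< (m ℕ.+ n) f ≡ ∑< m f + ∑< n (λ k → f (m ℕ.+ k))
  ∑<-++ m zero    f =
    trans (cong (λ l → ∑< l f) (ℕₚ.+-identityʳ m)) (sym (ℤₚ.+-identityʳ _))
  ∑<-++ m (suc n) f = trans (cong (λ l → ∑< l f) (ℕₚ.+-suc m n))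
    (trans (cong (_+ f (m ℕ.+ n)) (∑<-++ m n f)) (ℤₚ.+-assoc (∑< m f) _ _))

  ∑<-blocks : ∀ t m f → ∑< (t ℕ.* m) f ≡ ∑< t (λ i → ∑< m (λ k → f (i ℕ.* m ℕ.+ k)))
  ∑<-blocks zero    m f = refl
  ∑<-blocks (suc t) m f = trans (cong (λ l → ∑< l f) (ℕₚ.+-comm m (t ℕ.* m)))
    (trans (∑<-++ (t ℕ.* m) m f)
      (cong (_+ ∑< m (λ k → f (t ℕ.* m ℕ.+ k))) (∑<-blocks t m f)))

  ∑<-swap : ∀ m n (f : ℕ → ℕ → ℤ) →
            ∑< m (λ i → ∑< n (f i)) ≡ ∑< n (λ j → ∑< m (λ i → f i j))
  ∑<-swap zero    n f = sym (∑<-0 n)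
  ∑<-swap (suc m) n f = trans (cong (_+ ∑< n (f m)) (∑<-swap m n f))
    (sym (∑<-+ n (λ j → ∑< m (λ i → f i j)) (f m)))

  ∑<-single : ∀ n {f j} → j ℕ.< n → f j ≡ 1ℤ →
              (∀ i → i ℕ.< n → i ≢ j → f i ≡ 0ℤ) → ∑< n f ≡ 1ℤ
  ∑<-single (suc n) {f} {j} j<1+n fj≡1 rest with j ℕₚ.≟ n
  ... | yes refl = trans (cong₂ _+_ (trans zeros (∑<-0 n)) fj≡1) refl
    where
    zeros : ∑< n f ≡ ∑< n (λ _ → 0ℤ)
    zeros = ∑<-cong n (λ k k<n → rest k (ℕₚ.m<n⇒m<1+n k<n) (ℕₚ.<⇒≢ k<n))
  ... | no j≢n = cong₂ _+_
    (∑<-single n (ℕₚ.≤∧≢⇒< (ℕ.s≤s⁻¹ j<1+n) j≢n) fj≡1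
      (λ i i<n → rest i (ℕₚ.m<n⇒m<1+n i<n)))
    (rest n (ℕₚ.n<1+n n) (j≢n ∘ sym))

  ∣∑<∣≤ : ∀ n {f b} → (∀ k → ∣ f k ∣ ℕ.≤ b) → ∣ ∑< n f ∣ ℕ.≤ n ℕ.* b
  ∣∑<∣≤ zero    bound = ℕ.z≤n
  ∣∑<∣≤ (suc n) {f} {b} bound = begin
    ∣ ∑< n f + f n ∣       ≤⟨ ℤₚ.∣i+j∣≤∣i∣+∣j∣ (∑< n f) (f n) ⟩
    ∣ ∑< n f ∣ ℕ.+ ∣ f n ∣  ≤⟨ ℕₚ.+-mono-≤ (∣∑<∣≤ n bound) (bound n) ⟩
    n ℕ.* b ℕ.+ b          ≡⟨ ℕₚ.+-comm (n ℕ.* b) b ⟩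
    b ℕ.+ n ℕ.* b          ∎
    where open ℕₚ.≤-Reasoning

  i≤+∣i∣ : ∀ i → i ≤ + ∣ i ∣
  i≤+∣i∣ (+ n)        = ℤₚ.≤-refl
  i≤+∣i∣ -[1+ n ] = -≤+

  0≤i*i : ∀ i → 0ℤ ≤ i * i
  0≤i*i (+ n)        = subst (0ℤ ≤_) (ℤₚ.pos-* n n) (+≤+ ℕ.z≤n)
  0≤i*i -[1+ n ] = +≤+ ℕ.z≤n

  ∑<-nonNeg : ∀ n {f} → (∀ k → 0ℤ ≤ f k) → 0ℤ ≤ ∑< n f
  ∑<-nonNeg zero    0≤f = ℤₚ.≤-refl
  ∑<-nonNeg (suc n) 0≤f = ℤₚ.+-mono-≤ (∑<-nonNeg n 0≤f) (0≤f n)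

  module _ {f : ℕ → ℤ} where

    -- Deletes the term at a point already counted; this is how `length*≤∑<` counts every element of
    -- a repetition-free list once.
    removed : ℕ → ℕ → ℤ
    removed x k with k ℕₚ.≟ x
    ... | yes _ = 0ℤ
    ... | no  _ = f k

    removed-≢ : ∀ {x k} → k ≢ x → removed x k ≡ f k
    removed-≢ {x} {k} k≢x with k ℕₚ.≟ x
    ... | yes k≡x = contradiction k≡x k≢x
    ... | no  _   = refl

    removed-≡ : ∀ x → removed x x ≡ 0ℤ
    removed-≡ x with x ℕₚ.≟ x
    ... | yes _  = refl
    ... | no x≢x = contradiction refl x≢x

    0≤removed : (∀ k → 0ℤ ≤ f k) → ∀ x k → 0ℤ ≤ removed x k
    0≤removed 0≤f x k with k ℕₚ.≟ x
    ... | yes _ = ℤₚ.≤-refl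
    ... | no  _ = 0≤f k

    ∑<-removed : ∀ n {x} → x ℕ.< n → ∑< n f ≡ f x + ∑< n (removed x)
    ∑<-removed (suc n) {x} x<1+n with x ℕₚ.≟ n
    ... | yes refl = trans (ℤₚ.+-comm (∑< n f) (f n)) (cong (_+_ (f n))
      (trans (sym (ℤₚ.+-identityʳ _)) (cong₂ _+_
        (∑<-cong n (λ k k<n → sym (removed-≢ (ℕₚ.<⇒≢ k<n)))) (sym (removed-≡ n)))))
    ... | no x≢n = trans (cong₂ _+_ (∑<-removed n (ℕₚ.≤∧≢⇒< (ℕ.s≤s⁻¹ x<1+n) x≢n))
                                    (sym (removed-≢ (x≢n ∘ sym))))
                         (ℤₚ.+-assoc (f x) _ _)

  length*≤∑< : ∀ n {f c} xs → (∀ k → 0ℤ ≤ f k) → Unique xs → All (ℕ._< n) xs →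
               All (λ x → c ≤ f x) xs → + length xs * c ≤ ∑< n f
  length*≤∑< n []       0≤f _ _ _ = ∑<-nonNeg n 0≤f
  length*≤∑< n {f} {c} (x ∷ xs) 0≤f (x∉xs ∷ uxs) (x<n ∷ xs<n) (c≤fx ∷ c≤fxs) =
    subst₂ _≤_ lhs (sym (∑<-removed n x<n)) (ℤₚ.+-mono-≤ c≤fx
      (length*≤∑< n xs (0≤removed 0≤f x) uxs xs<n
        (All.zipWith (λ (x≢y , c≤fy) → subst (c ≤_) (sym (removed-≢ (x≢y ∘ sym))) c≤fy)
          (x∉xs , c≤fxs))))
    where
    identity : ∀ n c → c + n * c ≡ (1ℤ + n) * c
    identity = solve-∀
    lhs : c + + length xs * c ≡ + suc (length xs) * c
    lhs = trans (identity (+ length xs) c) (cong (_* c) (sym (ℤₚ.pos-+ 1 (length xs))))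

  ∑ : ∀ {A : Set} → List A → (A → ℕ) → ℕ
  ∑ []       f = 0
  ∑ (x ∷ xs) f = f x ℕ.+ ∑ xs f

  module QuadraticForm {A : Set} (w : A → ℕ) (φ : A → ℕ → ℤ) (N C E : ℕ) where

    linear : List A → ℕ → ℤ
    linear []       k = 0ℤ
    linear (i ∷ is) k = + w i * φ i k + linear is k

    private
      pair : A → A → ℤ
      pair i j = ∑< N (λ k → φ i k * φ j k)

    ∑φlinear≤ : ∀ i js → All (λ j → ∑< N (λ k → φ i k * φ j k) ≤ + E) js →
                ∑< N (λ k → φ i k * linear js k) ≤ + (E ℕ.* ∑ js w)
    ∑φlinear≤ i []       [] = ℤₚ.≤-reflexive (trans
      (trans (∑<-cong N (λ k _ → ℤₚ.*-zeroʳ (φ i k))) (∑<-0 N))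
      (cong +_ (sym (ℕₚ.*-zeroʳ E))))
    ∑φlinear≤ i (j ∷ js) (p ∷ ps) = subst₂ _≤_ (sym expand) bound
      (ℤₚ.+-mono-≤ (ℤₚ.*-monoˡ-≤-nonNeg (+ w j) p) (∑φlinear≤ i js ps))
      where
      identity : ∀ a w b c → a * (w * b + c) ≡ w * (a * b) + a * c
      identity = solve-∀
      expand : ∑< N (λ k → φ i k * linear (j ∷ js) k)
             ≡ + w j * pair i j + ∑< N (λ k → φ i k * linear js k)
      expand = trans (∑<-cong N (λ k _ → identity (φ i k) (+ w j) (φ j k) (linear js k)))
        (trans (∑<-+ N (λ k → + w j * (φ i k * φ j k)) (λ k → φ i k * linear js k))
          (cong (_+ ∑< N (λ k → φ i k * linear js k)) (∑<-*ˡ N (+ w j) (λ k → φ i k * φ j k))))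
      bound : + w j * + E + + (E ℕ.* ∑ js w) ≡ + (E ℕ.* (w j ℕ.+ ∑ js w))
      bound = trans (cong (_+ + (E ℕ.* ∑ js w)) (trans (ℤₚ.*-comm (+ w j) (+ E)) (sym (ℤₚ.pos-* E (w j)))))
        (trans (sym (ℤₚ.pos-+ (E ℕ.* w j) (E ℕ.* ∑ js w)))
          (cong +_ (sym (ℕₚ.*-distribˡ-+ E (w j) (∑ js w)))))

    -- A new index contributes its diagonal term and twice its cross terms. The summand `w i * E`
    -- allowed in the diagonal hypothesis completes the square: together with `2 * w i * G` and
    -- `G * G` it makes `(w i + G)²` the coefficient of `E`.
    ∑linear²≤ : ∀ is → All (λ i → + w i * ∑< N (λ k → φ i k * φ i k) ≤ + (C ℕ.+ w i ℕ.* E)) is →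
                AllPairs (λ i j → ∑< N (λ k → φ i k * φ j k) ≤ + E) is →
                ∑< N (λ k → linear is k * linear is k)
                  ≤ + (C ℕ.* ∑ is w ℕ.+ E ℕ.* (∑ is w ℕ.* ∑ is w))
    ∑linear²≤ [] _ _ = ℤₚ.≤-trans (ℤₚ.≤-reflexive (∑<-0 N)) (+≤+ ℕ.z≤n)
    ∑linear²≤ (i ∷ is) (d ∷ ds) (c ∷ cs) = subst₂ _≤_ (sym expand) bound
      (ℤₚ.+-mono-≤ (ℤₚ.+-mono-≤ (ℤₚ.*-monoˡ-≤-nonNeg (+ w i) d)
          (ℤₚ.*-monoˡ-≤-nonNeg (+ (2 ℕ.* w i)) (∑φlinear≤ i is c)))
        (∑linear²≤ is ds cs))
      where
      W G : ℕ
      W = w i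
      G = ∑ is w
      identity : ∀ w a f → (w * a + f) * (w * a + f) ≡ w * (w * (a * a)) + (+ 2 * w) * (a * f) + f * f
      identity = solve-∀
      expand : ∑< N (λ k → linear (i ∷ is) k * linear (i ∷ is) k)
             ≡ + W * (+ W * pair i i) + + (2 ℕ.* W) * ∑< N (λ k → φ i k * linear is k)
               + ∑< N (λ k → linear is k * linear is k)
      expand = trans (∑<-cong N (λ k _ → identity (+ W) (φ i k) (linear is k)))
        (trans (∑<-+ N (λ k → + W * (+ W * (φ i k * φ i k)) + (+ 2 * + W) * (φ i k * linear is k))
                       (λ k → linear is k * linear is k))
          (cong (_+ ∑< N (λ k → linear is k * linear is k))
            (trans (∑<-+ N (λ k → + W * (+ W * (φ i k * φ i k))) (λ k → (+ 2 * + W) * (φ i k * linear is k)))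
              (cong₂ _+_
                (trans (∑<-*ˡ N (+ W) (λ k → + W * (φ i k * φ i k)))
                  (cong (+ W *_) (∑<-*ˡ N (+ W) (λ k → φ i k * φ i k))))
                (trans (∑<-*ˡ N (+ 2 * + W) (λ k → φ i k * linear is k))
                  (cong (_* ∑< N (λ k → φ i k * linear is k)) (sym (ℤₚ.pos-* 2 W))))))))
      regroup : ∀ w c e g → w * (c + w * e) + (+ 2 * w) * (e * g) + (c * g + e * (g * g))
              ≡ c * (w + g) + e * ((w + g) * (w + g))
      regroup = solve-∀
      cast₁ : + (C ℕ.+ W ℕ.* E) ≡ + C + + W * + E
      cast₁ = trans (ℤₚ.pos-+ C (W ℕ.* E)) (cong (_+_ (+ C)) (ℤₚ.pos-* W E))
      cast₂ : ∀ X → + (C ℕ.* X ℕ.+ E ℕ.* (X ℕ.* X)) ≡ + C * + X + + E * (+ X * + X)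
      cast₂ X = trans (ℤₚ.pos-+ (C ℕ.* X) (E ℕ.* (X ℕ.* X)))
        (cong₂ _+_ (ℤₚ.pos-* C X) (trans (ℤₚ.pos-* E (X ℕ.* X)) (cong (+ E *_) (ℤₚ.pos-* X X))))
      bound : + W * + (C ℕ.+ W ℕ.* E) + + (2 ℕ.* W) * + (E ℕ.* G)
                + + (C ℕ.* G ℕ.+ E ℕ.* (G ℕ.* G))
            ≡ + (C ℕ.* (W ℕ.+ G) ℕ.+ E ℕ.* ((W ℕ.+ G) ℕ.* (W ℕ.+ G)))
      bound = trans (cong₂ _+_ (cong₂ _+_ (cong (+ W *_) cast₁)
                                          (cong₂ _*_ (ℤₚ.pos-* 2 W) (ℤₚ.pos-* E G)))
                               (cast₂ G))
        (trans (regroup (+ W) (+ C) (+ E) (+ G))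
          (trans (cong (λ z → + C * z + + E * (z * z)) (sym (ℤₚ.pos-+ W G)))
            (sym (cast₂ (W ℕ.+ G)))))

    linear≡∑ : ∀ {k} is → All (λ i → φ i k ≡ 1ℤ) is → linear is k ≡ + ∑ is w
    linear≡∑ []       []       = refl
    linear≡∑ (i ∷ is) (p ∷ ps) = trans
      (cong₂ _+_ (trans (cong (+ w i *_) p) (ℤₚ.*-identityʳ (+ w i))) (linear≡∑ is ps))
      (sym (ℤₚ.pos-+ (w i) (∑ is w)))

    -- Duality form of Selberg's sieve: bound |S| G² ≤ ∑ₖ (∑ᵢ wᵢ φᵢ(k))² from
    -- below on S, where every φᵢ is 1, and from above by almost orthogonality.
    sieve : ∀ is xs .{{_ : ℕ.NonZero (∑ is w)}} →
            All (λ i → + w i * ∑< N (λ k → φ i k * φ i k) ≤ + (C ℕ.+ w i ℕ.* E)) is →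
            AllPairs (λ i j → ∑< N (λ k → φ i k * φ j k) ≤ + E) is →
            Unique xs → All (ℕ._< N) xs → All (λ x → All (λ i → φ i x ≡ 1ℤ) is) xs →
            length xs ℕ.* ∑ is w ℕ.≤ C ℕ.+ E ℕ.* ∑ is w
    sieve is xs diagonal off-diagonal unique xs<N φ≡1 =
      ℕₚ.*-cancelʳ-≤ _ _ G (subst₂ ℕ._≤_ (sym (ℕₚ.*-assoc (length xs) G G)) regroup (ℤₚ.drop‿+≤+
        (subst (_≤ _) (trans (cong (+ length xs *_) (sym (ℤₚ.pos-* G G))) (sym (ℤₚ.pos-* (length xs) (G ℕ.* G))))
          (ℤₚ.≤-trans
            (length*≤∑< N xs (λ k → 0≤i*i (linear is k)) unique xs<N
              (All.map (λ p → ℤₚ.≤-reflexive (sym (cong₂ _*_ (linear≡∑ is p) (linear≡∑ is p)))) φ≡1))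
            (∑linear²≤ is diagonal off-diagonal)))))
      where
      G : ℕ
      G = ∑ is w
      regroup : C ℕ.* G ℕ.+ E ℕ.* (G ℕ.* G) ≡ (C ℕ.+ E ℕ.* G) ℕ.* G
      regroup = trans (cong (C ℕ.* G ℕ.+_) (sym (ℕₚ.*-assoc E G G))) (sym (ℕₚ.*-distribʳ-+ G C (E ℕ.* G)))

-- Orthogonal functions modulo a prime and their products over a full period.

module Local where

  open import Data.Integer.Base using (+_; _+_; _*_; _-_; -_; _≤_; ∣_∣)
  open ℤ-Ring using (solve-∀)
  open import Data.Nat.DivMod using (_/_; _%_; m≡m%n+[m/n]*n; m%n<n)
  open Sums

  prime∣prime⇒≡ : ∀ {p q} → Prime p → Prime q → p ∣ q → p ≡ q
  prime∣prime⇒≡ pp pq p∣q with prime⇒irreducible pq p∣q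
  ... | inj₁ refl = contradiction pp ¬prime[1]
  ... | inj₂ p≡q  = p≡q

  prime∤⇒coprime : ∀ {p m} → Prime p → ¬ p ∣ m → Coprime p m
  prime∤⇒coprime pp p∤m (d∣p , d∣m) with prime⇒irreducible pp d∣p
  ... | inj₁ d≡1  = d≡1
  ... | inj₂ refl = contradiction d∣m p∤m

  δ : ℕ → ℕ → ℤ
  δ p n with p ∣? n
  ... | yes _ = 1ℤ
  ... | no  _ = 0ℤ

  δ-yes : ∀ {p n} → p ∣ n → δ p n ≡ 1ℤ
  δ-yes {p} {n} p∣n with p ∣? n
  ... | yes _  = refl
  ... | no p∤n = contradiction p∣n p∤n

  δ-no : ∀ {p n} → ¬ p ∣ n → δ p n ≡ 0ℤ
  δ-no {p} {n} p∤n with p ∣? n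
  ... | yes p∣n = contradiction p∣n p∤n
  ... | no _    = refl

  δ-shift : ∀ p m n → p ∣ m → δ p (m ℕ.+ n) ≡ δ p n
  δ-shift p m n p∣m with p ∣? n
  ... | yes p∣n = δ-yes (∣m∣n⇒∣m+n p∣m p∣n)
  ... | no p∤n  = δ-no (λ p∣m+n → p∤n (∣m+n∣m⇒∣n p∣m+n p∣m))

  module _ {p m : ℕ} (coprime : Coprime p m) (c : ℕ) where

    reduce-mod : .{{_ : NonZero p}} → ∀ i → p ∣ i ℕ.* m ℕ.+ c → p ∣ i % p ℕ.* m ℕ.+ c
    reduce-mod i p∣ = ∣m+n∣m⇒∣n
      (subst (p ∣_) (trans (cong (λ j → j ℕ.* m ℕ.+ c) (m≡m%n+[m/n]*n i p))
        (shuffle (i % p) (i / p) p m c)) p∣)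
      (∣m⇒∣m*n m (n∣m*n (i / p)))
      where
      shuffle : ∀ r q p m c → (r ℕ.+ q ℕ.* p) ℕ.* m ℕ.+ c ≡ q ℕ.* p ℕ.* m ℕ.+ (r ℕ.* m ℕ.+ c)
      shuffle = ℕ-Ring.solve-∀

    solution : .{{_ : NonZero p}} → ∃[ i ] (i ℕ.< p × p ∣ i ℕ.* m ℕ.+ c)
    solution with coprime-Bézout coprime
    -- Here `y * m ≡ 1` modulo `p`, and `pred p * c` represents `- c` among the naturals. In the
    -- other case `y * m ≡ - 1`, and `c * y` itself is a solution.
    ... | Bézout.-+ x y eq = _ , m%n<n _ p , reduce-mod (ℕ.pred p ℕ.* c ℕ.* y)
        (divides (c ℕ.+ ℕ.pred p ℕ.* c ℕ.* x) (lemma p eq))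
      where
      identity₂ : ∀ p₋ c y m → p₋ ℕ.* c ℕ.* y ℕ.* m ℕ.+ c ≡ p₋ ℕ.* c ℕ.* (y ℕ.* m) ℕ.+ c
      identity₂ = ℕ-Ring.solve-∀
      identity₃ : ∀ p₋ c x → p₋ ℕ.* c ℕ.* (1 ℕ.+ x ℕ.* (1 ℕ.+ p₋)) ℕ.+ c
                           ≡ (c ℕ.+ p₋ ℕ.* c ℕ.* x) ℕ.* (1 ℕ.+ p₋)
      identity₃ = ℕ-Ring.solve-∀
      lemma : ∀ p → 1 ℕ.+ x ℕ.* p ≡ y ℕ.* m → .{{_ : NonZero p}} →
              ℕ.pred p ℕ.* c ℕ.* y ℕ.* m ℕ.+ c ≡ (c ℕ.+ ℕ.pred p ℕ.* c ℕ.* x) ℕ.* p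
      lemma (suc p₋) eq = trans (identity₂ p₋ c y m)
        (trans (cong (λ z → p₋ ℕ.* c ℕ.* z ℕ.+ c) (sym eq)) (identity₃ p₋ c x))
    ... | Bézout.+- x y eq = _ , m%n<n _ p , reduce-mod (c ℕ.* y) (divides (c ℕ.* x)
      (trans (identity₁ c y m) (trans (cong (c ℕ.*_) eq) (sym (ℕₚ.*-assoc c x p)))))
      where
      identity₁ : ∀ c y m → c ℕ.* y ℕ.* m ℕ.+ c ≡ c ℕ.* (1 ℕ.+ y ℕ.* m)
      identity₁ = ℕ-Ring.solve-∀

    solution-unique-≤ : ∀ {i j} → i ℕ.≤ j → j ℕ.< p →
                        p ∣ i ℕ.* m ℕ.+ c → p ∣ j ℕ.* m ℕ.+ c → i ≡ j
    solution-unique-≤ {i} i≤j j<p p∣i p∣j with d , refl ← ℕₚ.m≤n⇒∃[o]m+o≡n i≤j = gap d j<p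
      (coprime-divisor coprime (subst (p ∣_) (ℕₚ.*-comm d m)
        (∣m+n∣m⇒∣n (subst (p ∣_) (shuffle i d m c) p∣j) p∣i)))
      where
      shuffle : ∀ i d m c → (i ℕ.+ d) ℕ.* m ℕ.+ c ≡ (i ℕ.* m ℕ.+ c) ℕ.+ d ℕ.* m
      shuffle = ℕ-Ring.solve-∀
      gap : ∀ d → i ℕ.+ d ℕ.< p → p ∣ d → i ≡ i ℕ.+ d
      gap zero    _     _   = sym (ℕₚ.+-identityʳ i)
      gap (suc d) i+d<p p∣d = contradiction (∣⇒≤ p∣d)
        (ℕₚ.<⇒≱ (ℕₚ.≤-<-trans (ℕₚ.m≤n+m (suc d) i) i+d<p))

    solution-unique : ∀ {i j} → i ℕ.< p → j ℕ.< p →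
                      p ∣ i ℕ.* m ℕ.+ c → p ∣ j ℕ.* m ℕ.+ c → i ≡ j
    solution-unique {i} {j} i<p j<p p∣i p∣j with ℕₚ.≤-total i j
    ... | inj₁ i≤j = solution-unique-≤ i≤j j<p p∣i p∣j
    ... | inj₂ j≤i = sym (solution-unique-≤ j≤i i<p p∣j p∣i)

    -- As `m` is a unit modulo `p`, the progression `i * m + c` meets every residue class exactly
    -- once.
    ∑δ≡1 : .{{_ : NonZero p}} → ∑< p (λ i → δ p (i ℕ.* m ℕ.+ c)) ≡ 1ℤ
    ∑δ≡1 with j , j<p , p∣j ← solution = ∑<-single p j<p (δ-yes p∣j)
      (λ i i<p i≢j → δ-no (λ p∣i → i≢j (solution-unique i<p j<p p∣i p∣j)))

  -- The role of a prime `p` in the function of a pair `(a , b)`: `paired` if `p` is `b`, `shifted`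
  -- if `p` is another prime and divides `a`, and `none` otherwise.
  data Kind : Set where
    none shifted paired : Kind

  _≟ₖ_ : (s t : Kind) → Dec (s ≡ t)
  none    ≟ₖ none    = yes refl
  none    ≟ₖ shifted = no λ ()
  none    ≟ₖ paired  = no λ ()
  shifted ≟ₖ none    = no λ ()
  shifted ≟ₖ shifted = yes refl
  shifted ≟ₖ paired  = no λ ()
  paired  ≟ₖ none    = no λ ()
  paired  ≟ₖ shifted = no λ ()
  paired  ≟ₖ paired  = yes refl

  -- Three functions of k modulo p, mutually orthogonal and equal to 1 whenever
  -- p divides neither k nor k + 1; shifted detects p ∣ k + 1, and paired detects
  -- p ∣ k among the k with p ∤ k + 1.

  local : Kind → ℕ → ℕ → ℤ
  local none    p k = 1ℤ
  local shifted p k = 1ℤ - + p * δ p (suc k)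
  local paired  p k = 1ℤ - δ p (suc k) - (+ p - 1ℤ) * δ p k

  -- The indicators of `p ∣ k + 1` and `p ∣ k` are idempotent with product 0, so a product of two
  -- local functions is again affine in them; `β` and `γ` are its coefficients.
  β γ : Kind → Kind → ℤ → ℤ
  β none    none    p = 0ℤ
  β none    shifted p = - p
  β none    paired  p = - 1ℤ
  β shifted none    p = - p
  β shifted shifted p = p * p - + 2 * p
  β shifted paired  p = - 1ℤ
  β paired  none    p = - 1ℤ
  β paired  shifted p = - 1ℤ
  β paired  paired  p = - 1ℤ
  γ none    paired  p = 1ℤ - p
  γ shifted paired  p = 1ℤ - p
  γ paired  none    p = 1ℤ - p
  γ paired  shifted p = 1ℤ - p
  γ paired  paired  p = (p - + 2) * (p - + 2) - 1ℤ
  γ _       _       p = 0ℤ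

  δ-idempotent : ∀ p n → δ p n * δ p n - δ p n ≡ 0ℤ
  δ-idempotent p n with p ∣? n
  ... | yes _ = refl
  ... | no _  = refl

  δ-exclusive : ∀ {p} → Prime p → ∀ k → δ p (suc k) * δ p k ≡ 0ℤ
  δ-exclusive {p} pp k with p ∣? suc k | p ∣? k
  ... | no _      | no _    = refl
  ... | yes _     | no _    = refl
  ... | no _      | yes _   = refl
  ... | yes p∣1+k | yes p∣k = contradiction
    (subst Prime (∣1⇒≡1 (∣m+n∣m⇒∣n (subst (p ∣_) (ℕₚ.+-comm 1 k) p∣1+k) p∣k)) pp) ¬prime[1]

  local*local : ∀ {p} → Prime p → ∀ s t k →
    local s p k * local t p k ≡ 1ℤ + β s t (+ p) * δ p (suc k) + γ s t (+ p) * δ p k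
  local*local {p} pp s t k = by-kind s t
    where
    a b q : ℤ
    a = δ p (suc k)
    b = δ p k
    q = + p
    -- The affine forms hold only modulo the relations `a * a = a`, `b * b = b`, `a * b = 0`.
    -- Explicit multiples of these turn them into polynomial identities for the ring solver.
    vanish : ∀ {x} c₁ c₂ c₃ y → x ≡ y + (c₁ * (a * a - a) + c₂ * (b * b - b) + c₃ * (a * b)) → x ≡ y
    vanish c₁ c₂ c₃ y eq = trans eq (trans
      (cong (_+_ y) (cong₂ _+_ (cong₂ _+_
        (trans (cong (c₁ *_) (δ-idempotent p (suc k))) (ℤₚ.*-zeroʳ c₁))
        (trans (cong (c₂ *_) (δ-idempotent p k)) (ℤₚ.*-zeroʳ c₂)))
        (trans (cong (c₃ *_) (δ-exclusive pp k)) (ℤₚ.*-zeroʳ c₃))))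
      (ℤₚ.+-identityʳ y))
    nn : ∀ a b → 1ℤ * 1ℤ ≡ 1ℤ + 0ℤ * a + 0ℤ * b
    nn = solve-∀
    ns : ∀ q a b → 1ℤ * (1ℤ - q * a) ≡ 1ℤ + (- q) * a + 0ℤ * b
    ns = solve-∀
    np : ∀ q a b → 1ℤ * (1ℤ - a - (q - 1ℤ) * b) ≡ 1ℤ + (- 1ℤ) * a + (1ℤ - q) * b
    np = solve-∀
    ss : ∀ q a b → (1ℤ - q * a) * (1ℤ - q * a) ≡ 1ℤ + (q * q - + 2 * q) * a + 0ℤ * b
         + (q * q * (a * a - a) + 0ℤ * (b * b - b) + 0ℤ * (a * b))
    ss = solve-∀
    sp : ∀ q a b → (1ℤ - q * a) * (1ℤ - a - (q - 1ℤ) * b) ≡ 1ℤ + (- 1ℤ) * a + (1ℤ - q) * b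
         + (q * (a * a - a) + 0ℤ * (b * b - b) + (q * (q - 1ℤ)) * (a * b))
    sp = solve-∀
    p-p : ∀ q a b → (1ℤ - a - (q - 1ℤ) * b) * (1ℤ - a - (q - 1ℤ) * b)
         ≡ 1ℤ + (- 1ℤ) * a + ((q - + 2) * (q - + 2) - 1ℤ) * b
         + (1ℤ * (a * a - a) + ((q - 1ℤ) * (q - 1ℤ)) * (b * b - b) + (+ 2 * (q - 1ℤ)) * (a * b))
    p-p = solve-∀
    by-kind : ∀ s t → local s p k * local t p k ≡ 1ℤ + β s t q * a + γ s t q * b
    by-kind none    none    = nn a b
    by-kind none    shifted = ns q a b
    by-kind none    paired  = np q a b
    by-kind shifted none    = trans (ℤₚ.*-comm (1ℤ - q * a) 1ℤ) (ns q a b)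
    by-kind shifted shifted = vanish (q * q) 0ℤ 0ℤ _ (ss q a b)
    by-kind shifted paired  = vanish q 0ℤ (q * (q - 1ℤ)) _ (sp q a b)
    by-kind paired  none    = trans (ℤₚ.*-comm (1ℤ - a - (q - 1ℤ) * b) 1ℤ) (np q a b)
    by-kind paired  shifted = trans (ℤₚ.*-comm (1ℤ - a - (q - 1ℤ) * b) (1ℤ - q * a))
                                    (vanish q 0ℤ (q * (q - 1ℤ)) _ (sp q a b))
    by-kind paired  paired  = vanish 1ℤ ((q - 1ℤ) * (q - 1ℤ)) (+ 2 * (q - 1ℤ)) _ (p-p q a b)

  local-sum : Kind → Kind → ℤ → ℤ
  local-sum s t q = q + β s t q + γ s t q

  -- The argument is `i * m + c` because `m` will be the period of the other primes: `i` numbers the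
  -- block and `c` is the offset in it. The constant 1 sums to `p`, and each indicator is 1 exactly
  -- once.
  ∑-local*local : ∀ {p} (pp : Prime p) m → Coprime p m → ∀ s t c →
    ∑< p (λ i → local s p (i ℕ.* m ℕ.+ c) * local t p (i ℕ.* m ℕ.+ c)) ≡ local-sum s t (+ p)
  ∑-local*local {p} pp m coprime s t c = trans
    (∑<-cong p (λ i _ → trans (local*local pp s t (i ℕ.* m ℕ.+ c))
      (cong (λ n → 1ℤ + B * δ p n + Γ * δ p (i ℕ.* m ℕ.+ c)) (sym (ℕₚ.+-suc (i ℕ.* m) c)))))
    (trans (∑<-+ p (λ i → 1ℤ + B * δ p (i ℕ.* m ℕ.+ suc c)) (λ i → Γ * δ p (i ℕ.* m ℕ.+ c)))
      (cong₂ _+_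
        (trans (∑<-+ p (λ _ → 1ℤ) (λ i → B * δ p (i ℕ.* m ℕ.+ suc c)))
          (cong₂ _+_ (trans (∑<-const p 1ℤ) (ℤₚ.*-identityʳ (+ p))) (total B (suc c))))
        (total Γ c)))
    where
    instance
      p≢0 : NonZero p
      p≢0 = prime⇒nonZero pp
    B Γ : ℤ
    B = β s t (+ p)
    Γ = γ s t (+ p)
    total : ∀ X c → ∑< p (λ i → X * δ p (i ℕ.* m ℕ.+ c)) ≡ X
    total X c = trans (∑<-*ˡ p X (λ i → δ p (i ℕ.* m ℕ.+ c)))
      (trans (cong (X *_) (∑δ≡1 coprime c)) (ℤₚ.*-identityʳ X))

  -- `shifted` and `paired` have mean zero. Moreover `paired` vanishes on the class `p ∣ k + 1`,
  -- outside which `shifted` is 1, so the product of the two is `paired` again.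
  local-orthogonal : ∀ s t q → s ≢ t → local-sum s t q ≡ 0ℤ
  local-orthogonal s t q = by-kind s t
    where
    identity₁ : ∀ q → q + - q + 0ℤ ≡ 0ℤ
    identity₁ = solve-∀
    identity₂ : ∀ q → q + - 1ℤ + (1ℤ - q) ≡ 0ℤ
    identity₂ = solve-∀
    by-kind : ∀ s t → s ≢ t → local-sum s t q ≡ 0ℤ
    by-kind none    shifted _ = identity₁ q
    by-kind none    paired  _ = identity₂ q
    by-kind shifted none    _ = identity₁ q
    by-kind shifted paired  _ = identity₂ q
    by-kind paired  none    _ = identity₂ q
    by-kind paired  shifted _ = identity₂ q
    by-kind none    none    s≢s = contradiction refl s≢s
    by-kind shifted shifted s≢s = contradiction refl s≢s
    by-kind paired  paired  s≢s = contradiction refl s≢s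

  -- Primes that enter neither factor are left out of the period. Otherwise the period would be the
  -- product of all primes up to `A`, far too large for the error term.
  modulus : Kind → Kind → ℕ → ℕ
  modulus none none p = 1
  modulus _    _    p = p

  norm : Kind → Kind → ℕ → ℤ
  norm none none p = 1ℤ
  norm s    t    p = local-sum s t (+ p)

  module _ (s t : ℕ → Kind) where

    product-of-locals : List ℕ → ℕ → ℤ
    product-of-locals []       k = 1ℤ
    product-of-locals (p ∷ ps) k = (local (s p) p k * local (t p) p k) * product-of-locals ps k

    period : List ℕ → ℕ
    period []       = 1
    period (p ∷ ps) = modulus (s p) (t p) p ℕ.* period ps

    total : List ℕ → ℤ
    total []       = 1ℤ
    total (p ∷ ps) = norm (s p) (t p) p * total ps

  local-shift : ∀ s p m k → p ∣ m → local s p (m ℕ.+ k) ≡ local s p k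
  local-shift none    p m k p∣m = refl
  local-shift shifted p m k p∣m = cong (λ z → 1ℤ - + p * z)
    (trans (cong (δ p) (sym (ℕₚ.+-suc m k))) (δ-shift p m (suc k) p∣m))
  local-shift paired  p m k p∣m = cong₂ (λ y z → 1ℤ - y - (+ p - 1ℤ) * z)
    (trans (cong (δ p) (sym (ℕₚ.+-suc m k))) (δ-shift p m (suc k) p∣m)) (δ-shift p m k p∣m)

  local*local-shift : ∀ s t p m k → modulus s t p ∣ m →
    local s p (m ℕ.+ k) * local t p (m ℕ.+ k) ≡ local s p k * local t p k
  local*local-shift none    none    p m k _   = refl
  local*local-shift none    shifted p m k p∣m = cong (1ℤ *_) (local-shift shifted p m k p∣m)
  local*local-shift none    paired  p m k p∣m = cong (1ℤ *_) (local-shift paired p m k p∣m)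
  local*local-shift shifted t       p m k p∣m = cong₂ _*_ (local-shift shifted p m k p∣m) (local-shift t p m k p∣m)
  local*local-shift paired  t       p m k p∣m = cong₂ _*_ (local-shift paired p m k p∣m) (local-shift t p m k p∣m)

  modulus-cases : ∀ s t p → (s ≡ none × t ≡ none) ⊎ (modulus s t p ≡ p × norm s t p ≡ local-sum s t (+ p))
  modulus-cases none    none    p = inj₁ (refl , refl)
  modulus-cases none    shifted p = inj₂ (refl , refl)
  modulus-cases none    paired  p = inj₂ (refl , refl)
  modulus-cases shifted t       p = inj₂ (refl , refl)
  modulus-cases paired  t       p = inj₂ (refl , refl)

  module _ {s t : ℕ → Kind} where

    product-shift : ∀ ps m k → period s t ps ∣ m →
      product-of-locals s t ps (m ℕ.+ k) ≡ product-of-locals s t ps k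
    product-shift []       m k _   = refl
    product-shift (p ∷ ps) m k per∣m = cong₂ _*_
      (local*local-shift (s p) (t p) p m k (∣-trans (m∣m*n (period s t ps)) per∣m))
      (product-shift ps m k (∣-trans (n∣m*n (modulus (s p) (t p) p)) per∣m))

    prime∣period⇒∈ : ∀ {p} → Prime p → ∀ {ps} → All Prime ps → p ∣ period s t ps → p ∈ ps
    prime∣period⇒∈ pp []          p∣1 = contradiction (subst Prime (∣1⇒≡1 p∣1) pp) ¬prime[1]
    prime∣period⇒∈ pp {q ∷ ps} (pq ∷ pps) p∣per with euclidsLemma (modulus (s q) (t q) q) (period s t ps) pp p∣per
    ... | inj₂ p∣ = there (prime∣period⇒∈ pp pps p∣)
    ... | inj₁ p∣ with modulus-cases (s q) (t q) q
    ...   | inj₁ (eq₁ , eq₂) = contradiction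
      (subst Prime (∣1⇒≡1 (subst (_ ∣_) (cong₂ (λ a b → modulus a b q) eq₁ eq₂) p∣)) pp) ¬prime[1]
    ...   | inj₂ (eq , _) = here (prime∣prime⇒≡ pp pq (subst (_ ∣_) eq p∣))

    -- Chinese remainder theorem. With `m` the period of the remaining primes, their product depends
    -- only on the offset `k` in `i * m + k`; for fixed `k` the sum over `i` runs through all
    -- residues modulo `p`, since `p` does not divide `m`.
    ∑-period : ∀ {ps} → All Prime ps → Unique ps →
      ∑< (period s t ps) (product-of-locals s t ps) ≡ total s t ps
    ∑-period {[]}     []         []          = refl
    ∑-period {p ∷ ps} (pp ∷ pps) (p∉ps ∷ ups) with modulus-cases (s p) (t p) p
    ... | inj₁ (eq₁ , eq₂) rewrite eq₁ | eq₂ = trans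
      (trans (cong (λ n → ∑< n (λ k → (1ℤ * 1ℤ) * product-of-locals s t ps k)) (ℕₚ.*-identityˡ (period s t ps)))
        (∑<-cong (period s t ps) (λ k _ → ℤₚ.*-identityˡ (product-of-locals s t ps k))))
      (trans (∑-period pps ups) (sym (ℤₚ.*-identityˡ (total s t ps))))
    ... | inj₂ (eq₁ , eq₂) rewrite eq₁ | eq₂ = begin
      ∑< (p ℕ.* m) (λ k → E k * R k)                              ≡⟨ ∑<-blocks p m (λ k → E k * R k) ⟩
      ∑< p (λ i → ∑< m (λ k → E (i ℕ.* m ℕ.+ k) * R (i ℕ.* m ℕ.+ k))) ≡⟨ ∑<-cong p (λ i _ → ∑<-cong m (λ k _ →
        trans (cong (E (i ℕ.* m ℕ.+ k) *_) (product-shift ps (i ℕ.* m) k (n∣m*n i)))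
              (ℤₚ.*-comm (E (i ℕ.* m ℕ.+ k)) (R k)))) ⟩
      ∑< p (λ i → ∑< m (λ k → R k * E (i ℕ.* m ℕ.+ k)))           ≡⟨ ∑<-swap p m (λ i k → R k * E (i ℕ.* m ℕ.+ k)) ⟩
      ∑< m (λ k → ∑< p (λ i → R k * E (i ℕ.* m ℕ.+ k)))           ≡⟨ ∑<-cong m (λ k _ →
        trans (∑<-*ˡ p (R k) (λ i → E (i ℕ.* m ℕ.+ k)))
          (trans (cong (R k *_) (∑-local*local pp m coprime (s p) (t p) k))
                 (ℤₚ.*-comm (R k) S))) ⟩
      ∑< m (λ k → S * R k)                                        ≡⟨ ∑<-*ˡ m S R ⟩
      S * ∑< m R                                                  ≡⟨ cong (S *_) (∑-period pps ups) ⟩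
      S * total s t ps                                            ∎
      where
      open ≡-Reasoning
      m : ℕ
      m = period s t ps
      E R : ℕ → ℤ
      E k = local (s p) p k * local (t p) p k
      R = product-of-locals s t ps
      S : ℤ
      S = local-sum (s p) (t p) (+ p)
      coprime : Coprime p m
      coprime = prime∤⇒coprime pp (λ p∣m → All¬⇒¬Any p∉ps (prime∣period⇒∈ pp pps p∣m))

-- Correlations over an interval of arbitrary length.

module Orthogonality where

  open import Data.Integer.Base using (+_; _+_; _*_; _-_; -_; _≤_; ∣_∣)
  open ℤ-Ring using (solve-∀)
  open import Data.Nat.DivMod using (_/_; _%_; m≡m%n+[m/n]*n; m%n<n; m/n*n≤m)
  open Sums
  open Local

  ∣local∣≤ : ∀ s {p} → Prime p → ∀ k → ∣ local s p k ∣ ℕ.≤ p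
  ∣local∣≤ s {2+ n} pp k = bound s
    where
    bound : ∀ s → ∣ local s (2+ n) k ∣ ℕ.≤ 2+ n
    bound none = s≤s z≤n
    bound shifted with 2+ n ∣? suc k
    ... | yes _ = subst (ℕ._≤ 2+ n) (sym (trans (cong (λ z → ∣ 1ℤ - z ∣) (ℤₚ.*-identityʳ (+ 2+ n))) refl)) (ℕₚ.n≤1+n (suc n))
    ... | no _  = subst (λ z → ∣ 1ℤ - z ∣ ℕ.≤ 2+ n) (sym (ℤₚ.*-zeroʳ (+ 2+ n))) (s≤s z≤n)
    bound paired with 2+ n ∣? suc k | 2+ n ∣? k
    ... | yes _ | yes _ = subst (λ z → ∣ 1ℤ - 1ℤ - z ∣ ℕ.≤ 2+ n) (sym (ℤₚ.*-identityʳ (+ suc n))) (ℕₚ.n≤1+n (suc n))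
    ... | yes _ | no _  = subst (λ z → ∣ 1ℤ - 1ℤ - z ∣ ℕ.≤ 2+ n) (sym (ℤₚ.*-zeroʳ (+ suc n))) z≤n
    ... | no _  | yes _ = subst (λ z → ∣ 1ℤ - 0ℤ - z ∣ ℕ.≤ 2+ n) (sym (ℤₚ.*-identityʳ (+ suc n)))
      (subst (ℕ._≤ 2+ n) (sym (trans (cong ∣_∣ (ℤₚ.[1+m]⊖[1+n]≡m⊖n 0 n)) (ℤₚ.∣m⊖n∣≡∣n⊖m∣ 0 n)))
        (ℕₚ.≤-trans (ℕₚ.n≤1+n n) (ℕₚ.n≤1+n (suc n))))
    ... | no _  | no _  = subst (λ z → ∣ 1ℤ - 0ℤ - z ∣ ℕ.≤ 2+ n) (sym (ℤₚ.*-zeroʳ (+ suc n))) (s≤s z≤n)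

  -- The exact values are `(p - 1) * p` for `shifted` and `(p - 2) * (p - 1)` for `paired`. Spread
  -- over `p` residues, the mean square is at most `p`, which is the origin of the weights 1/(a b).
  ∣norm∣≤ : ∀ s {p} → Prime p → ∣ norm s s p ∣ ℕ.≤ modulus s s p ℕ.* modulus s s p
  ∣norm∣≤ s {2+ n} pp = bound s
    where
    shifted-identity : ∀ n → (+ 2 + n) + ((+ 2 + n) * (+ 2 + n) - + 2 * (+ 2 + n)) + 0ℤ ≡ (+ 1 + n) * (+ 2 + n)
    shifted-identity = solve-∀
    paired-identity : ∀ n → (+ 2 + n) + - 1ℤ + ((+ 2 + n - + 2) * (+ 2 + n - + 2) - 1ℤ) ≡ n * (+ 1 + n)
    paired-identity = solve-∀
    bound : ∀ s → ∣ norm s s (2+ n) ∣ ℕ.≤ modulus s s (2+ n) ℕ.* modulus s s (2+ n)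
    bound none = s≤s z≤n
    bound shifted = subst (ℕ._≤ 2+ n ℕ.* 2+ n) (sym (trans (cong ∣_∣ (shifted-identity (+ n))) (ℤₚ.abs-* (+ suc n) (+ 2+ n))))
      (ℕₚ.*-monoˡ-≤ (2+ n) (ℕₚ.n≤1+n (suc n)))
    bound paired = subst (ℕ._≤ 2+ n ℕ.* 2+ n) (sym (trans (cong ∣_∣ (paired-identity (+ n))) (ℤₚ.abs-* (+ n) (+ suc n))))
      (ℕₚ.*-mono-≤ (ℕₚ.m≤n+m n 2) (ℕₚ.n≤1+n (suc n)))

  ∣local*local∣≤ : ∀ s t {p} → Prime p → ∀ k →
    ∣ local s p k * local t p k ∣ ℕ.≤ modulus s t p ℕ.* modulus s t p
  ∣local*local∣≤ s t {p} pp k with modulus-cases s t p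
  ... | inj₁ (refl , refl) = s≤s z≤n
  ... | inj₂ (eq , _) rewrite eq | ℤₚ.abs-* (local s p k) (local t p k) =
    ℕₚ.*-mono-≤ (∣local∣≤ s pp k) (∣local∣≤ t pp k)

  squares : ∀ a b {x y} → x ℕ.≤ a ℕ.* a → y ℕ.≤ b ℕ.* b → x ℕ.* y ℕ.≤ (a ℕ.* b) ℕ.* (a ℕ.* b)
  squares a b p q = ℕₚ.≤-trans (ℕₚ.*-mono-≤ p q) (ℕₚ.≤-reflexive (identity a b))
    where
    identity : ∀ a b → (a ℕ.* a) ℕ.* (b ℕ.* b) ≡ (a ℕ.* b) ℕ.* (a ℕ.* b)
    identity = ℕ-Ring.solve-∀

  module _ (s t : ℕ → Kind) where

    ∣product∣≤ : ∀ {ps} → All Prime ps → ∀ k →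
      ∣ product-of-locals s t ps k ∣ ℕ.≤ period s t ps ℕ.* period s t ps
    ∣product∣≤ []                  k = s≤s z≤n
    ∣product∣≤ {p ∷ ps} (pp ∷ pps) k
      rewrite ℤₚ.abs-* (local (s p) p k * local (t p) p k) (product-of-locals s t ps k) =
      squares (modulus (s p) (t p) p) (period s t ps)
        (∣local*local∣≤ (s p) (t p) pp k) (∣product∣≤ pps k)

    total≡0 : ∀ {p ps} → p ∈ ps → s p ≢ t p → total s t ps ≡ 0ℤ
    total≡0 {p} {q ∷ ps} (here refl) sp≢tp with modulus-cases (s p) (t p) p
    ... | inj₁ (eq₁ , eq₂) = contradiction (trans eq₁ (sym eq₂)) sp≢tp
    ... | inj₂ (_ , eq) rewrite eq | local-orthogonal (s p) (t p) (+ p) sp≢tp = refl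
    total≡0 {p} {q ∷ ps} (there p∈ps) sp≢tp =
      trans (cong (norm (s q) (t q) q *_) (total≡0 p∈ps sp≢tp)) (ℤₚ.*-zeroʳ (norm (s q) (t q) q))

    period≢0 : ∀ {ps} → All Prime ps → NonZero (period s t ps)
    period≢0 []                  = _
    period≢0 {p ∷ ps} (pp ∷ pps) with modulus-cases (s p) (t p) p
    ... | inj₁ (eq₁ , eq₂) rewrite eq₁ | eq₂ = ℕₚ.m*n≢0 1 (period s t ps) {{_}} {{period≢0 pps}}
    ... | inj₂ (eq , _) rewrite eq = ℕₚ.m*n≢0 p (period s t ps) {{prime⇒nonZero pp}} {{period≢0 pps}}

  ∣total∣≤ : ∀ s {ps} → All Prime ps → ∣ total s s ps ∣ ℕ.≤ period s s ps ℕ.* period s s ps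
  ∣total∣≤ s []         = s≤s z≤n
  ∣total∣≤ s {p ∷ ps} (pp ∷ pps) rewrite ℤₚ.abs-* (norm (s p) (s p) p) (total s s ps) =
    squares (modulus (s p) (s p) p) (period s s ps) (∣norm∣≤ (s p) pp) (∣total∣≤ s pps)

  module _ (s t : ℕ → Kind) {ps} (pps : All Prime ps) (ups : Unique ps) (N : ℕ) where

    private
      instance
        per≢0 : NonZero (period s t ps)
        per≢0 = period≢0 s t pps
      P : ℕ
      P = period s t ps
      Φ : ℕ → ℤ
      Φ = product-of-locals s t ps

    ∑<-product : ∑< N Φ ≡ + (N / P) * total s t ps + ∑< (N % P) Φ
    ∑<-product = begin
      ∑< N Φ ≡⟨ cong (λ n → ∑< n Φ) (trans (m≡m%n+[m/n]*n N P) (ℕₚ.+-comm (N % P) (N / P ℕ.* P))) ⟩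
      ∑< (N / P ℕ.* P ℕ.+ N % P) Φ ≡⟨ ∑<-++ (N / P ℕ.* P) (N % P) Φ ⟩
      ∑< (N / P ℕ.* P) Φ + ∑< (N % P) (λ k → Φ (N / P ℕ.* P ℕ.+ k)) ≡⟨ cong₂ _+_
        (trans (∑<-blocks (N / P) P Φ)
          (trans (∑<-cong (N / P) (λ i _ → trans
            (∑<-cong P (λ k _ → product-shift ps (i ℕ.* P) k (n∣m*n i))) (∑-period pps ups)))
            (∑<-const (N / P) (total s t ps))))
        (∑<-cong (N % P) (λ k _ → product-shift ps (N / P ℕ.* P) k (n∣m*n (N / P)))) ⟩
      + (N / P) * total s t ps + ∑< (N % P) Φ ∎
      where open ≡-Reasoning

    -- Fewer than `P` terms are left over, each of absolute value at most `P * P`. Any fixed power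
    -- of the period is affordable, because `A` is a small power of `N`.
    remainder≤ : ∑< (N % P) Φ ≤ + (P ℕ.* (P ℕ.* P))
    remainder≤ = ℤₚ.≤-trans (i≤+∣i∣ _) (+≤+ (ℕₚ.≤-trans (∣∑<∣≤ (N % P) (∣product∣≤ s t pps))
      (ℕₚ.*-monoˡ-≤ (P ℕ.* P) (ℕₚ.<⇒≤ (m%n<n N P)))))

    almost-orthogonal : ∀ {p} → p ∈ ps → s p ≢ t p → ∑< N Φ ≤ + (P ℕ.* (P ℕ.* P))
    almost-orthogonal p∈ps sp≢tp = subst (_≤ + (P ℕ.* (P ℕ.* P))) (sym (trans ∑<-product
      (trans (cong (λ z → + (N / P) * z + ∑< (N % P) Φ) (total≡0 s t p∈ps sp≢tp))
        (trans (cong (_+ ∑< (N % P) Φ) (ℤₚ.*-zeroʳ (+ (N / P)))) (ℤₚ.+-identityˡ _)))))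
      remainder≤

  -- Each of the `N / P` complete periods contributes at most `P * P`, in total at most `N * P`; the
  -- cube bounds the incomplete one.
  almost-normalised : ∀ s {ps} (pps : All Prime ps) (ups : Unique ps) N →
    let P = period s s ps in ∑< N (product-of-locals s s ps) ≤ + (N ℕ.* P ℕ.+ P ℕ.* (P ℕ.* P))
  almost-normalised s {ps} pps ups N = subst₂ _≤_ (sym (∑<-product s s pps ups N))
    (sym (ℤₚ.pos-+ (N ℕ.* P) (P ℕ.* (P ℕ.* P))))
    (ℤₚ.+-mono-≤ (ℤₚ.≤-trans (ℤₚ.*-monoˡ-≤-nonNeg (+ (N / P)) (i≤+∣i∣ (total s s ps)))
      (subst (_≤ + (N ℕ.* P)) (ℤₚ.pos-* (N / P) ∣ total s s ps ∣) (+≤+ main-term)))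
      (remainder≤ s s pps ups N))
    where
    P : ℕ
    P = period s s ps
    instance
      per≢0 : NonZero P
      per≢0 = period≢0 s s pps
    main-term : N / P ℕ.* ∣ total s s ps ∣ ℕ.≤ N ℕ.* P
    main-term = begin
      N / P ℕ.* ∣ total s s ps ∣ ≤⟨ ℕₚ.*-monoʳ-≤ (N / P) (∣total∣≤ s pps) ⟩
      N / P ℕ.* (P ℕ.* P)       ≡⟨ ℕₚ.*-assoc (N / P) P P ⟨
      N / P ℕ.* P ℕ.* P         ≤⟨ ℕₚ.*-monoˡ-≤ P (m/n*n≤m N P) ⟩
      N ℕ.* P                   ∎
      where open ℕₚ.≤-Reasoning

-- The functions attached to pairs `(a , b)` and the sieve bound they give.

module PairSieve where

  open import Data.Nat.Base
  open import Data.Nat.Properties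
  open import Data.Integer.Base using (+_)
  open Sums
  open Local
  open Orthogonality

  prime∣^⇒≡ : ∀ {p q} → Prime p → Prime q → ∀ e → p ∣ q ^ e → p ≡ q
  prime∣^⇒≡ pp pq zero    p∣1 = contradiction (subst Prime (∣1⇒≡1 p∣1) pp) ¬prime[1]
  prime∣^⇒≡ {q = q} pp pq (suc e) p∣ with euclidsLemma q (q ^ e) pp p∣
  ... | inj₁ p∣q  = prime∣prime⇒≡ pp pq p∣q
  ... | inj₂ p∣qᵉ = prime∣^⇒≡ pp pq e p∣qᵉ

  coprime-*-∣ : ∀ {m n k} → Coprime m n → m ∣ k → n ∣ k → m * n ∣ k
  coprime-*-∣ {m} {n} c m∣k (divides q refl) =
    subst₂ _∣_ (*-comm n m) (*-comm n q)
      (*-monoʳ-∣ n (coprime-divisor c (subst (m ∣_) (*-comm q n) m∣k)))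

  -- The prime factors of `k` are cancelled one at a time from `k` and from `n`. Cancelling `p`
  -- lowers the exponent of `p` by one on both sides, and powers of any other prime survive because
  -- they are coprime to `p`.
  ∣-from-prime-powers : ∀ k .{{_ : NonZero k}} n →
    (∀ p e → Prime p → p ^ e ∣ k → p ^ e ∣ n) → k ∣ n
  ∣-from-prime-powers k n hyp = subst (_∣ n) (sym isFactorisation)
    (go factors factorsPrime n (λ p e pp pᵉ∣ → hyp p e pp (subst (p ^ e ∣_) (sym isFactorisation) pᵉ∣)))
    where
    open PrimeFactorisation (factorise k)
    go : ∀ ps → All Prime ps → ∀ n →
         (∀ p e → Prime p → p ^ e ∣ product ps → p ^ e ∣ n) → product ps ∣ n
    go []       _          n hyp = 1∣ n
    go (p ∷ ps) (pp ∷ pps) n hyp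
      with divides q refl ← subst (_∣ n) (*-identityʳ p)
             (hyp p 1 pp (subst (_∣ product (p ∷ ps)) (sym (*-identityʳ p)) (m∣m*n (product ps)))) =
      subst (p * product ps ∣_) (*-comm p q) (*-monoʳ-∣ p (go ps pps q step))
      where
      step : ∀ r e → Prime r → r ^ e ∣ product ps → r ^ e ∣ q
      step r e pr rᵉ∣ with r ≟ p
      ... | yes refl = *-cancelˡ-∣ p {{prime⇒nonZero pp}}
        (subst (p * p ^ e ∣_) (*-comm q p) (hyp p (suc e) pp (*-monoʳ-∣ p rᵉ∣)))
      ... | no r≢p = coprime-divisor coprime
        (subst (r ^ e ∣_) (*-comm q p) (hyp r e pr (∣n⇒∣m*n p rᵉ∣)))
        where
        coprime : Coprime (r ^ e) p
        coprime (d∣rᵉ , d∣p) with prime⇒irreducible pp d∣p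
        ... | inj₁ d≡1  = d≡1
        ... | inj₂ refl = contradiction (sym (prime∣^⇒≡ pp pr e d∣rᵉ)) r≢p

  Squarefree : ℕ → Set
  Squarefree n = ∀ d → d * d ∣ n → d ≡ 1

  squarefree-∣ : ∀ {k} .{{_ : NonZero k}} n → Squarefree k →
                 (∀ p → Prime p → p ∣ k → p ∣ n) → k ∣ n
  squarefree-∣ {k} n sqf hyp = ∣-from-prime-powers k n powers
    where
    powers : ∀ p e → Prime p → p ^ e ∣ k → p ^ e ∣ n
    powers p zero          pp _   = 1∣ n
    powers p (suc zero)    pp p∣k = subst (_∣ n) (sym (*-identityʳ p)) (hyp p pp (subst (_∣ k) (*-identityʳ p) p∣k))
    powers p (suc (suc e)) pp pᵉ∣k = contradiction
      (subst Prime (sqf p (∣-trans (divides (p ^ e) (trans (sym (*-assoc p p (p ^ e))) (*-comm (p * p) (p ^ e)))) pᵉ∣k)) pp)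
      ¬prime[1]

  -- Distinct primes are coprime, so their product divides what each of them divides. With `n` equal
  -- to `a * b` or `(a * b) * (a′ * b′)` this bounds the periods in the sieve.
  period-∣ : ∀ (s t : ℕ → Kind) {ps} n → All Prime ps → Unique ps →
             (∀ p → p ∈ ps → s p ≢ none ⊎ t p ≢ none → p ∣ n) → period s t ps ∣ n
  period-∣ s t n []         []           _   = 1∣ n
  period-∣ s t {p ∷ ps} n (pp ∷ pps) (p∉ps ∷ ups) hyp with modulus-cases (s p) (t p) p
  ... | inj₁ (eq₁ , eq₂) rewrite eq₁ | eq₂ =
    subst (_∣ n) (sym (*-identityˡ _)) (period-∣ s t n pps ups (λ q → hyp q ∘ there))
  ... | inj₂ (eq , _) = subst (λ m → m * period s t ps ∣ n) (sym eq) (coprime-*-∣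
      (prime∤⇒coprime pp (λ p∣ → All¬⇒¬Any p∉ps (prime∣period⇒∈ {s} {t} pp pps p∣)))
      p∣n
      (period-∣ s t n pps ups (λ q → hyp q ∘ there)))
    where
    p∣n : p ∣ n
    p∣n with s p ≟ₖ none | t p ≟ₖ none
    ... | no sp≢  | _       = hyp p (here refl) (inj₁ sp≢)
    ... | yes _   | no tp≢  = hyp p (here refl) (inj₂ tp≢)
    ... | yes eq₁ | yes eq₂ = contradiction
      (subst Prime (trans (sym eq) (cong₂ (λ a b → modulus a b p) eq₁ eq₂)) pp) ¬prime[1]

  kind : ℕ × ℕ → ℕ → Kind
  kind (a , b) p with p ≟ b | p ∣? a
  ... | yes _ | _     = paired
  ... | no _  | yes _ = shifted
  ... | no _  | no _  = none

  kind-paired : ∀ {a b p} → kind (a , b) p ≡ paired → p ≡ b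
  kind-paired {a} {b} {p} eq with p ≟ b | p ∣? a
  ... | yes p≡b | _ = p≡b
  kind-paired () | no _ | yes _
  kind-paired () | no _ | no _

  kind-≡ : ∀ a b → kind (a , b) b ≡ paired
  kind-≡ a b with b ≟ b | b ∣? a
  ... | yes _  | _ = refl
  ... | no b≢b | _ = contradiction refl b≢b

  kind-shifted : ∀ {a b p} → p ∣ a → p ≢ b → kind (a , b) p ≡ shifted
  kind-shifted {a} {b} {p} p∣a p≢b with p ≟ b | p ∣? a
  ... | yes p≡b | _      = contradiction p≡b p≢b
  ... | no _    | yes _  = refl
  ... | no _    | no p∤a = contradiction p∣a p∤a

  kind-shifted⁻ : ∀ {a b p} → kind (a , b) p ≡ shifted → p ∣ a
  kind-shifted⁻ {a} {b} {p} eq with p ≟ b | p ∣? a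
  ... | no _ | yes p∣a = p∣a
  kind-shifted⁻ () | yes _ | _
  kind-shifted⁻ () | no _ | no _

  kind-≢none : ∀ {a b p} → kind (a , b) p ≢ none → p ∣ a * b
  kind-≢none {a} {b} {p} ≢none with p ≟ b | p ∣? a
  ... | yes refl | _       = n∣m*n a
  ... | no _     | yes p∣a = ∣m⇒∣m*n b p∣a
  ... | no _     | no _    = contradiction refl ≢none

  φ : List ℕ → ℕ × ℕ → ℕ → ℤ
  φ []       i k = 1ℤ
  φ (p ∷ ps) i k = local (kind i p) p k ℤ.* φ ps i k

  φ*φ : ∀ ps i j k → φ ps i k ℤ.* φ ps j k ≡ product-of-locals (kind i) (kind j) ps k
  φ*φ []       i j k = refl
  φ*φ (p ∷ ps) i j k = trans
    (shuffle (local (kind i p) p k) (φ ps i k) (local (kind j p) p k) (φ ps j k))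
    (cong (local (kind i p) p k ℤ.* local (kind j p) p k ℤ.*_) (φ*φ ps i j k))
    where
    shuffle : ∀ a b c d → (a ℤ.* b) ℤ.* (c ℤ.* d) ≡ (a ℤ.* c) ℤ.* (b ℤ.* d)
    shuffle = ℤ-Ring.solve-∀

  φ≡1 : ∀ ps {a b k} → (∀ p → p ∈ ps → ¬ p ∣ suc k) → ¬ b ∣ k → φ ps (a , b) k ≡ 1ℤ
  φ≡1 []       _    _   = refl
  φ≡1 (p ∷ ps) {a} {b} {k} p∤1+k b∤k = cong₂ ℤ._*_ local≡1 (φ≡1 ps (λ q → p∤1+k q ∘ there) b∤k)
    where
    local≡1 : local (kind (a , b) p) p k ≡ 1ℤ
    local≡1 with p ≟ b | p ∣? a
    ... | no _     | no _  = refl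
    ... | no _     | yes _ = trans (cong (λ z → 1ℤ ℤ.- + p ℤ.* z) (δ-no (p∤1+k p (here refl))))
                                   (cong (ℤ._-_ 1ℤ) (ℤₚ.*-zeroʳ (+ p)))
    ... | yes refl | _     = trans (cong₂ (λ y z → 1ℤ ℤ.- y ℤ.- (+ p ℤ.- 1ℤ) ℤ.* z)
                                     (δ-no (p∤1+k p (here refl))) (δ-no b∤k))
                                   (cong (ℤ._-_ (1ℤ ℤ.- 0ℤ)) (ℤₚ.*-zeroʳ (+ p ℤ.- 1ℤ)))

  -- Conditions that allow a pair to be recovered from its kinds at the primes of `ps`: a squarefree
  -- `a` is determined by its prime divisors, all of which lie in `ps`, and `b` is not one of them.
  record Admissible (ps : List ℕ) (i : ℕ × ℕ) : Set where
    field
      a≢0        : NonZero (proj₁ i)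
      squarefree : Squarefree (proj₁ i)
      b∈ps       : proj₂ i ∈ ps
      b∤a        : ¬ proj₂ i ∣ proj₁ i
      support    : ∀ p → Prime p → p ∣ proj₁ i → p ∈ ps

  open Admissible

  -- If the second components differ, the prime `b` tells the pairs apart, being `paired` for only
  -- one of them. If they agree and no kind differs, `a` and `a′` have the same prime divisors and,
  -- being squarefree, divide each other.
  kinds-differ : ∀ {ps i j} → Admissible ps i → Admissible ps j → i ≢ j →
                 ∃[ p ] (p ∈ ps × kind i p ≢ kind j p)
  kinds-differ {ps} {a , b} {a′ , b′} ai aj i≢j with b ≟ b′
  ... | no b≢b′ = b , b∈ps ai , λ eq → b≢b′ (kind-paired (trans (sym eq) (kind-≡ a b)))
  ... | yes refl with any? (λ p → ¬? (kind (a , b) p ≟ₖ kind (a′ , b) p)) ps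
  ...   | yes found     = find found
  ...   | no none-found = contradiction (cong (_, b) (∣-antisym
            (transfer ai same) (transfer aj (λ p p∈ps → sym (same p p∈ps))))) i≢j
    where
    same : ∀ p → p ∈ ps → kind (a , b) p ≡ kind (a′ , b) p
    same p p∈ps = decidable-stable (_ ≟ₖ _) (λ ≢ → none-found (lose p∈ps ≢))
    transfer : ∀ {c d} → Admissible ps (c , b) → (∀ p → p ∈ ps → kind (c , b) p ≡ kind (d , b) p) → c ∣ d
    transfer {c} {d} ac same = squarefree-∣ {{a≢0 ac}} d (squarefree ac) (λ p pp p∣c → kind-shifted⁻ {d} {b} {p}
      (trans (sym (same p (support ac p pp p∣c)))
        (kind-shifted {c} {b} {p} p∣c (λ { refl → b∤a ac p∣c }))))

  module _ {ps} (pps : All Prime ps) (ups : Unique ps) (w : ℕ × ℕ → ℕ) (N M Q : ℕ) .{{_ : NonZero Q}} where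

    private
      -- The cube of `Q * Q`: a product of two functions has period at most `Q * Q`, and an
      -- incomplete period costs at most the cube of the period.
      E : ℕ
      E = (Q * Q) * ((Q * Q) * (Q * Q))

      cube-mono : ∀ {x y} → x ≤ y → x * (x * x) ≤ y * (y * y)
      cube-mono x≤y = *-mono-≤ x≤y (*-mono-≤ x≤y x≤y)

    -- The last condition says that `w i` is at most `M / (a * b)`, where `a * b` bounds the mean
    -- square of the function; it makes every diagonal term at most `N * M` plus an error.
    Small : ℕ × ℕ → Set
    Small i = Admissible ps i × proj₁ i * proj₂ i ≤ Q × w i * (proj₁ i * proj₂ i) ≤ M

    private
      ab≢0 : ∀ {i} → Small i → NonZero (proj₁ i * proj₂ i)
      ab≢0 {a , b} (ai , _) = m*n≢0 a b {{a≢0 ai}} {{prime⇒nonZero (All.lookup pps (b∈ps ai))}}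

      diagonal : ∀ {i} → Small i → + w i ℤ.* ∑< N (λ k → φ ps i k ℤ.* φ ps i k) ℤ.≤ + (N * M + w i * E)
      diagonal {i@(a , b)} si@(ai , ab≤Q , w*ab≤M) = ℤₚ.≤-trans
        (ℤₚ.*-monoˡ-≤-nonNeg (+ w i) (subst (ℤ._≤ + (N * P + P * (P * P)))
          (∑<-cong N (λ k _ → sym (φ*φ ps i i k))) (almost-normalised (kind i) pps ups N)))
        (subst (ℤ._≤ + (N * M + w i * E)) (ℤₚ.pos-* (w i) (N * P + P * (P * P))) (+≤+ bound))
        where
        P : ℕ
        P = period (kind i) (kind i) ps
        P≤ab : P ≤ a * b
        P≤ab = ∣⇒≤ {{ab≢0 si}} (period-∣ (kind i) (kind i) (a * b) pps ups
          λ { p _ (inj₁ ≢) → kind-≢none {a} {b} ≢ ; p _ (inj₂ ≢) → kind-≢none {a} {b} ≢ })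
        bound : w i * (N * P + P * (P * P)) ≤ N * M + w i * E
        bound = begin
          w i * (N * P + P * (P * P))       ≡⟨ *-distribˡ-+ (w i) (N * P) (P * (P * P)) ⟩
          w i * (N * P) + w i * (P * (P * P)) ≡⟨ cong (_+ w i * (P * (P * P))) (x∙yz≈y∙xz (w i) N P) ⟩
          N * (w i * P) + w i * (P * (P * P)) ≤⟨ +-mono-≤
            (*-monoʳ-≤ N (≤-trans (*-monoʳ-≤ (w i) P≤ab) w*ab≤M))
            (*-monoʳ-≤ (w i) (cube-mono (≤-trans P≤ab (≤-trans ab≤Q (m≤m*n Q Q))))) ⟩
          N * M + w i * E                   ∎
          where
          open ≤-Reasoning
          open import Algebra.Properties.CommutativeSemigroup *-commutativeSemigroup using (x∙yz≈y∙xz)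

      off-diagonal : ∀ {i j} → Small i → Small j → i ≢ j → ∑< N (λ k → φ ps i k ℤ.* φ ps j k) ℤ.≤ + E
      off-diagonal {i@(a , b)} {j@(a′ , b′)} si@(ai , ab≤Q , _) sj@(aj , ab≤Q′ , _) i≢j
        with p , p∈ps , differ ← kinds-differ ai aj i≢j = ℤₚ.≤-trans
        (subst (ℤ._≤ + (P * (P * P))) (∑<-cong N (λ k _ → sym (φ*φ ps i j k)))
          (almost-orthogonal (kind i) (kind j) pps ups N p∈ps differ))
        (+≤+ (cube-mono (≤-trans P≤ (*-mono-≤ ab≤Q ab≤Q′))))
        where
        P : ℕ
        P = period (kind i) (kind j) ps
        P≤ : P ≤ (a * b) * (a′ * b′)
        P≤ = ∣⇒≤ {{m*n≢0 _ _ {{ab≢0 si}} {{ab≢0 sj}}}} (period-∣ (kind i) (kind j) _ pps ups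
          λ { p _ (inj₁ ≢) → ∣m⇒∣m*n (a′ * b′) (kind-≢none {a} {b} ≢)
            ; p _ (inj₂ ≢) → ∣n⇒∣m*n (a * b) (kind-≢none {a′} {b′} ≢) })

      all-pairs : ∀ {is} → All Small is → Unique is →
                  AllPairs (λ i j → ∑< N (λ k → φ ps i k ℤ.* φ ps j k) ℤ.≤ + E) is
      all-pairs []         []           = []
      all-pairs (si ∷ sis) (i∉is ∷ uis) =
        All.zipWith (λ (i≢j , sj) → off-diagonal si sj i≢j) (i∉is , sis) ∷ all-pairs sis uis

    pair-sieve : ∀ is xs .{{_ : NonZero (∑ is w)}} → Unique is → All Small is →
      Unique xs → All (_< N) xs →
      All (λ k → (∀ p → p ∈ ps → ¬ p ∣ suc k) × All (λ i → ¬ proj₂ i ∣ k) is) xs →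
      length xs * ∑ is w ≤ N * M + E * ∑ is w
    pair-sieve is xs uis sis uxs xs<N sifted = QuadraticForm.sieve w (φ ps) N (N * M) E is xs
      (All.map diagonal sis) (all-pairs sis uis) uxs xs<N
      (All.map (λ (p∤ , b∤) → All.map (λ b∤k → φ≡1 ps p∤ b∤k) b∤) sifted)

-- Chebyshev's bounds for the number of primes.

module Chebyshev where

  open import Data.Nat.Base
  open import Data.Nat.Properties
  open ℕ-Ring using (solve-∀)
  open Sums
  open Local
  open PairSieve

  ∑-mono : ∀ {A : Set} xs {f g : A → ℕ} → (∀ x → x ∈ xs → f x ≤ g x) → ∑ xs f ≤ ∑ xs g
  ∑-mono []       f≤g = z≤n
  ∑-mono (x ∷ xs) f≤g = +-mono-≤ (f≤g x (here refl)) (∑-mono xs (λ y → f≤g y ∘ there))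

  ∑-*ʳ : ∀ {A : Set} (xs : List A) f c → ∑ xs (λ x → f x * c) ≡ ∑ xs f * c
  ∑-*ʳ []       f c = refl
  ∑-*ʳ (x ∷ xs) f c = trans (cong (f x * c +_) (∑-*ʳ xs f c)) (sym (*-distribʳ-+ c (f x) (∑ xs f)))

  ∑-const : ∀ {A : Set} (xs : List A) c → ∑ xs (λ _ → c) ≡ length xs * c
  ∑-const []       c = refl
  ∑-const (x ∷ xs) c = cong (c +_) (∑-const xs c)

  ∑-++ : ∀ {A : Set} (xs ys : List A) f → ∑ (xs ++ ys) f ≡ ∑ xs f + ∑ ys f
  ∑-++ []       ys f = refl
  ∑-++ (x ∷ xs) ys f = trans (cong (f x +_) (∑-++ xs ys f)) (sym (+-assoc (f x) _ _))

  ∑-map : ∀ {A B : Set} (h : A → B) xs f → ∑ (map h xs) f ≡ ∑ xs (f ∘ h)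
  ∑-map h []       f = refl
  ∑-map h (x ∷ xs) f = cong (f (h x) +_) (∑-map h xs f)

  ∑-⊆ : ∀ {A : Set} {xs ys : List A} f → Unique xs → (∀ {x} → x ∈ xs → x ∈ ys) → ∑ xs f ≤ ∑ ys f
  ∑-⊆ {xs = []}     f _ _ = z≤n
  ∑-⊆ {xs = x ∷ xs} f (x∉xs ∷ uxs) xs⊆ys with as , bs , refl ← ∈-∃++ (xs⊆ys (here refl)) = begin
    f x + ∑ xs f              ≤⟨ +-monoʳ-≤ (f x) (∑-⊆ f uxs xs⊆as++bs) ⟩
    f x + ∑ (as ++ bs) f      ≡⟨ cong (f x +_) (∑-++ as bs f) ⟩
    f x + (∑ as f + ∑ bs f)   ≡⟨ x∙yz≈y∙xz (f x) (∑ as f) (∑ bs f) ⟩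
    ∑ as f + (f x + ∑ bs f)   ≡⟨ ∑-++ as (x ∷ bs) f ⟨
    ∑ (as ++ x ∷ bs) f        ∎
    where
    open ≤-Reasoning
    open import Algebra.Properties.CommutativeSemigroup +-commutativeSemigroup using (x∙yz≈y∙xz)
    xs⊆as++bs : ∀ {y} → y ∈ xs → y ∈ as ++ bs
    xs⊆as++bs y∈xs with ∈-++⁻ as (xs⊆ys (there y∈xs))
    ... | inj₁ y∈as         = ∈-++⁺ˡ y∈as
    ... | inj₂ (here refl)  = contradiction refl (All.lookup x∉xs y∈xs)
    ... | inj₂ (there y∈bs) = ∈-++⁺ʳ as y∈bs

  length-⊆ : ∀ {A : Set} {xs ys : List A} → Unique xs → (∀ {x} → x ∈ xs → x ∈ ys) → length xs ≤ length ys
  length-⊆ {xs = xs} {ys} uxs xs⊆ys = subst₂ _≤_ (count xs) (count ys) (∑-⊆ (λ _ → 1) uxs xs⊆ys)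
    where
    count : ∀ zs → ∑ zs (λ _ → 1) ≡ length zs
    count zs = trans (∑-const zs 1) (*-identityʳ (length zs))

  abstract

    primesIn : ℕ → ℕ → List ℕ
    primesIn m n = filter (λ p → prime? p ×-dec m <? p) (upTo (suc n))

    primesIn-unique : ∀ m n → Unique (primesIn m n)
    primesIn-unique m n = Unique.filter⁺ (λ p → prime? p ×-dec m <? p) (Unique.upTo⁺ (suc n))

    ∈-primesIn⁺ : ∀ {m n p} → Prime p → m < p → p ≤ n → p ∈ primesIn m n
    ∈-primesIn⁺ {m} pp m<p p≤n = ∈-filter⁺ (λ p → prime? p ×-dec m <? p) (∈-upTo⁺ (s≤s p≤n)) (pp , m<p)

    ∈-primesIn⁻ : ∀ {m n p} → p ∈ primesIn m n → Prime p × m < p × p ≤ n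
    ∈-primesIn⁻ {m} {n} p∈
      with p∈upTo , pp , m<p ← ∈-filter⁻ (λ p → prime? p ×-dec m <? p) {xs = upTo (suc n)} p∈ =
      pp , m<p , s≤s⁻¹ (∈-upTo⁻ p∈upTo)

    length-primesIn≤ : ∀ m n → length (primesIn m n) ≤ suc n
    length-primesIn≤ m n = ≤-trans (length-filter (λ p → prime? p ×-dec m <? p) (upTo (suc n)))
      (≤-reflexive (length-upTo (suc n)))

  primesIn-prime : ∀ m n → All Prime (primesIn m n)
  primesIn-prime m n = All.tabulate (proj₁ ∘ ∈-primesIn⁻)

  prime>0 : ∀ {p} → Prime p → 0 < p
  prime>0 pp = >-nonZero⁻¹ _ {{prime⇒nonZero pp}}

  prime>1 : ∀ {p} → Prime p → 1 < p
  prime>1 pp = nonTrivial⇒n>1 _ {{prime⇒nonTrivial pp}}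

  π : ℕ → ℕ
  π n = length (primesIn 0 n)

  binom : ℕ → ℕ → ℕ
  binom n       zero    = 1
  binom zero    (suc k) = 0
  binom (suc n) (suc k) = binom n k + binom n (suc k)

  binom-absorption : ∀ n k → suc k * binom (suc n) (suc k) ≡ suc n * binom n k
  binom-absorption zero    zero    = refl
  binom-absorption zero    (suc k) = *-zeroʳ k
  binom-absorption (suc n) zero    = cong suc (trans (+-identityʳ _) (trans (sym (+-identityʳ _)) (binom-absorption n zero)))
  binom-absorption (suc n) (suc k) = begin
    suc (suc k) * (binom (suc n) (suc k) + binom (suc n) (suc (suc k)))
      ≡⟨ *-distribˡ-+ (suc (suc k)) (binom (suc n) (suc k)) _ ⟩
    suc (suc k) * binom (suc n) (suc k) + suc (suc k) * binom (suc n) (suc (suc k))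
      ≡⟨ cong₂ (λ y z → binom (suc n) (suc k) + y + z) (binom-absorption n k) (binom-absorption n (suc k)) ⟩
    binom (suc n) (suc k) + suc n * binom n k + suc n * binom n (suc k)
      ≡⟨ regroup (binom n k) (binom n (suc k)) n ⟩
    suc (suc n) * binom (suc n) (suc k) ∎
    where
    open ≡-Reasoning
    regroup : ∀ a b n → a + b + suc n * a + suc n * b ≡ suc (suc n) * (a + b)
    regroup = solve-∀

  binom-factorial : ∀ m n → binom (m + n) m * (m ! * n !) ≡ (m + n) !
  binom-factorial zero    n = trans (+-identityʳ _) (+-identityʳ (n !))
  binom-factorial (suc m) n = begin
    binom (suc m + n) (suc m) * (suc m * m ! * n !) ≡⟨ shuffle₁ (binom (suc m + n) (suc m)) m (m !) (n !) ⟩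
    suc m * binom (suc m + n) (suc m) * (m ! * n !) ≡⟨ cong (_* (m ! * n !)) (binom-absorption (m + n) m) ⟩
    suc (m + n) * binom (m + n) m * (m ! * n !)     ≡⟨ *-assoc (suc (m + n)) (binom (m + n) m) (m ! * n !) ⟩
    suc (m + n) * (binom (m + n) m * (m ! * n !))   ≡⟨ cong (suc (m + n) *_) (binom-factorial m n) ⟩
    suc (m + n) * (m + n) !                         ∎
    where
    open ≡-Reasoning
    shuffle₁ : ∀ b m x y → b * (suc m * x * y) ≡ suc m * b * (x * y)
    shuffle₁ = solve-∀

  binom≤2^ : ∀ n k → binom n k ≤ 2 ^ n
  binom≤2^ n       zero    = m^n>0 2 n
  binom≤2^ zero    (suc k) = z≤n
  binom≤2^ (suc n) (suc k) = ≤-trans (+-mono-≤ (binom≤2^ n k) (binom≤2^ n (suc k)))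
    (≤-reflexive (cong (2 ^ n +_) (sym (+-identityʳ (2 ^ n)))))

  -- By Pascal's rule the next central coefficient is the sum of two entries of row `2n + 1`, and
  -- each of these is at least the central entry of row `2n`.
  2^≤central-binom : ∀ n → 2 ^ n ≤ binom (n + n) n
  2^≤central-binom zero    = s≤s z≤n
  2^≤central-binom (suc n) rewrite +-suc n n = begin
    2 * 2 ^ n                         ≤⟨ *-monoʳ-≤ 2 (2^≤central-binom n) ⟩
    2 * binom (n + n) n               ≡⟨ cong (binom (n + n) n +_) (+-identityʳ _) ⟩
    binom (n + n) n + binom (n + n) n ≤⟨ +-mono-≤ (below n) (m≤m+n _ _) ⟩
    binom (suc (n + n)) n + binom (suc (n + n)) (suc n) ∎
    where
    open ≤-Reasoning
    below : ∀ k → binom (n + n) k ≤ binom (suc (n + n)) k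
    below zero    = s≤s z≤n
    below (suc k) = m≤n+m _ _

  binom>0 : ∀ {n k} → k ≤ n → 0 < binom n k
  binom>0 z≤n       = s≤s z≤n
  binom>0 (s≤s k≤n) = ≤-trans (binom>0 k≤n) (m≤m+n _ _)

  -- Leibniz's harmonic triangle: 1/((n+1) C(n,k+1)) = 1/(n C(n-1,k)) - 1/((n+1) C(n,k)),
  -- so a common multiple of 1, …, n + 1 clears all denominators of row n.

  leibniz-∣ : ∀ n k {D} → k ≤ n → (∀ i .{{_ : NonZero i}} → i ≤ suc n → i ∣ D) → suc n * binom n k ∣ D
  leibniz-∣ n       zero    {D} _    common = subst (_∣ D) (sym (*-identityʳ (suc n))) (common (suc n) ≤-refl)
  leibniz-∣ (suc n) (suc k) {D} (s≤s k≤n) common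
    with divides q eqA ← leibniz-∣ (suc n) k {D} (m≤n⇒m≤1+n k≤n) common
       | divides r eqB ← leibniz-∣ n k {D} k≤n (λ i i≤ → common i (m≤n⇒m≤1+n i≤)) =
    -- Here `r = D / B` and `q = D / A`, and the identity `A * B + C * B ≡ C * A` says 1/C = 1/B -
    -- 1/A. Hence `r ∸ q` is `D / C`.
    divides (r ∸ q) (*-cancelˡ-≡ D _ (A * B) {{m*n≢0 A B}} (begin
      A * B * D               ≡⟨ m+n∸n≡m (A * B * D) (C * B * D) ⟨
      A * B * D + C * B * D ∸ C * B * D ≡⟨ cong (_∸ C * B * D)
        (trans (sym (*-distribʳ-+ D (A * B) (C * B))) (cong (_* D) identity)) ⟩
      C * A * D ∸ C * B * D   ≡⟨ cong₂ _∸_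
        (trans (cong (C * A *_) eqB) (shuffle₁ C A B r))
        (trans (cong (C * B *_) eqA) (shuffle₂ C A B q)) ⟩
      A * B * C * r ∸ A * B * C * q ≡⟨ *-distribˡ-∸ (A * B * C) r q ⟨
      A * B * C * (r ∸ q)     ≡⟨ trans (*-assoc (A * B) C (r ∸ q)) (cong (A * B *_) (*-comm C (r ∸ q))) ⟩
      A * B * ((r ∸ q) * C)   ∎))
    where
    open ≡-Reasoning
    A B C : ℕ
    A = suc (suc n) * binom (suc n) k
    B = suc n * binom n k
    C = suc (suc n) * binom (suc n) (suc k)
    instance
      A≢0 : NonZero A
      A≢0 = m*n≢0 (suc (suc n)) (binom (suc n) k) {{_}} {{>-nonZero (binom>0 (m≤n⇒m≤1+n k≤n))}}
      B≢0 : NonZero B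
      B≢0 = m*n≢0 (suc n) (binom n k) {{_}} {{>-nonZero (binom>0 k≤n)}}
    shuffle₁ : ∀ C A B r → C * A * (r * B) ≡ A * B * C * r
    shuffle₁ = solve-∀
    shuffle₂ : ∀ C A B q → C * B * (q * A) ≡ A * B * C * q
    shuffle₂ = solve-∀
    identity : A * B + C * B ≡ C * A
    identity = begin
      A * B + C * B ≡⟨ factor (suc (suc n)) (binom (suc n) k) B (binom (suc n) (suc k)) ⟩
      suc (suc n) * binom (suc (suc n)) (suc k) * B
        ≡⟨ cong (suc (suc n) * binom (suc (suc n)) (suc k) *_) (sym (binom-absorption n k)) ⟩
      suc (suc n) * binom (suc (suc n)) (suc k) * (suc k * binom (suc n) (suc k))
        ≡⟨ shuffle₃ (suc (suc n)) (binom (suc (suc n)) (suc k)) (suc k) (binom (suc n) (suc k)) ⟩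
      C * (suc k * binom (suc (suc n)) (suc k)) ≡⟨ cong (C *_) (binom-absorption (suc n) k) ⟩
      C * A ∎
      where
      factor : ∀ n a b c → n * a * b + n * c * b ≡ n * (a + c) * b
      factor = solve-∀
      shuffle₃ : ∀ n a k b → n * a * (k * b) ≡ n * b * (k * a)
      shuffle₃ = solve-∀

  floor-log : ℕ → ℕ → ℕ
  floor-log p zero    = 0
  floor-log p (suc n) with p ^ suc (floor-log p n) ≤? suc n
  ... | yes _ = suc (floor-log p n)
  ... | no _  = floor-log p n

  ^floor-log≤ : ∀ p n → p ^ floor-log p (suc n) ≤ suc n
  ^floor-log≤ p n with p ^ suc (floor-log p n) ≤? suc n
  ... | yes le = le
  ^floor-log≤ p zero    | no _ = s≤s z≤n
  ^floor-log≤ p (suc n) | no _ = m≤n⇒m≤1+n (^floor-log≤ p n)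

  <^1+floor-log : ∀ {p} → 1 < p → ∀ n → n < p ^ suc (floor-log p n)
  <^1+floor-log {p} 1<p zero = m^n>0 p {{>-nonZero (<-trans z<s 1<p)}} 1
  <^1+floor-log {p} 1<p (suc n) with p ^ suc (floor-log p n) ≤? suc n
  ... | yes le = ≤-<-trans (<^1+floor-log 1<p n)
    (subst (p ^ suc (floor-log p n) <_) (*-comm (p ^ suc (floor-log p n)) p)
      (m<m*n (p ^ suc (floor-log p n)) p {{m^n≢0 p (suc (floor-log p n)) {{>-nonZero (<-trans z<s 1<p)}}}} 1<p))
  ... | no ¬le = ≰⇒> ¬le

  product-map≤ : ∀ (f : ℕ → ℕ) xs {n} → (∀ x → f x ≤ n) → product (map f xs) ≤ n ^ length xs
  product-map≤ f []       f≤n = ≤-refl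
  product-map≤ f (x ∷ xs) f≤n = *-mono-≤ (f≤n x) (product-map≤ f xs f≤n)

  ^-monoʳ-∣ : ∀ p {m n} → m ≤ n → p ^ m ∣ p ^ n
  ^-monoʳ-∣ p {m} m≤n with o , refl ← m≤n⇒∃[o]m+o≡n m≤n =
    subst (p ^ m ∣_) (sym (^-distribˡ-+-* p m o)) (m∣m*n (p ^ o))

  -- The least common multiple of 1, ..., n + 1 in factored form. It is a product over the primes up
  -- to `n + 1` of prime powers not exceeding `n + 1`, whence the upper bound.
  common-multiple : ∀ n → ∃[ D ] (0 < D × D ≤ suc n ^ π (suc n) × (∀ i .{{_ : NonZero i}} → i ≤ suc n → i ∣ D))
  common-multiple n = D , D>0 , product-map≤ power primes {suc n} (λ p → ^floor-log≤ p n) , divisor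
    where
    primes : List ℕ
    primes = primesIn 0 (suc n)
    power : ℕ → ℕ
    power p = p ^ floor-log p (suc n)
    D : ℕ
    D = product (map power primes)
    product>0 : ∀ {ps} → All Prime ps → 0 < product (map power ps)
    product>0 []         = s≤s z≤n
    product>0 {p ∷ _} (pp ∷ pps) =
      *-mono-< {0} {power p} {0} (m^n>0 p {{prime⇒nonZero pp}} (floor-log p (suc n))) (product>0 pps)
    D>0 : 0 < D
    D>0 = product>0 (primesIn-prime 0 (suc n))
    divisor : ∀ i .{{_ : NonZero i}} → i ≤ suc n → i ∣ D
    divisor i i≤ = ∣-from-prime-powers i D powers
      where
      powers : ∀ p e → Prime p → p ^ e ∣ i → p ^ e ∣ D
      powers p zero    pp _   = 1∣ D
      powers p (suc e) pp pᵉ∣ = ∣-trans (^-monoʳ-∣ p e≤)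
        (∈⇒∣product (∈-map⁺ power (∈-primesIn⁺ pp (prime>0 pp) (≤-trans (∣⇒≤ (∣-trans (m∣m*n (p ^ e)) pᵉ∣)) i≤))))
        where
        e≤ : suc e ≤ floor-log p (suc n)
        e≤ = s≤s⁻¹ (≰⇒> (λ le → <-irrefl refl (<-≤-trans (<^1+floor-log (prime>1 pp) (suc n))
          (≤-trans (^-monoʳ-≤ p {{prime⇒nonZero pp}} le) (≤-trans (∣⇒≤ pᵉ∣) i≤)))))

  2^-cancel-≤ : ∀ m n → 2 ^ m ≤ 2 ^ n → m ≤ n
  2^-cancel-≤ m n le = ≮⇒≥ (λ n<m → <⇒≱ (^-monoʳ-< 2 (s≤s (s≤s z≤n)) n<m) le)

  n+n≡2*n : ∀ n → n + n ≡ 2 * n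
  n+n≡2*n n = cong (n +_) (sym (+-identityʳ n))

  -- Nair's argument. With `h = 2 ^ i`, the number (2h + 1) C(2h, h) is at least `2 ^ h` and divides
  -- a common multiple of 1, ..., 4h that is at most (4h)^π(4h); then exponents of 2 are compared.
  -- Rounding 2h + 1 up to 4h keeps to powers of 2.
  chebyshev-lower : ∀ i → 2 ^ i ≤ (2 + i) * π (2 ^ (2 + i))
  chebyshev-lower i =
    2^-cancel-≤ _ _ (bound (pred (2 ^ (2 + i))) (sym (suc-pred (2 ^ (2 + i)) {{m^n≢0 2 (2 + i)}})))
    where
    h : ℕ
    h = 2 ^ i
    h+h<4h : suc (h + h) ≤ 2 ^ (2 + i)
    h+h<4h = ≤-trans (+-monoˡ-≤ (h + h) (m^n>0 2 i))
      (≤-trans (m≤m+n (h + (h + h)) h) (≤-reflexive (regroup h)))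
      where
      regroup : ∀ h → h + (h + h) + h ≡ 2 * (2 * h)
      regroup = solve-∀
    bound : ∀ n → 2 ^ (2 + i) ≡ suc n → 2 ^ h ≤ 2 ^ ((2 + i) * π (2 ^ (2 + i)))
    bound n eq with D , D>0 , D≤ , common ← common-multiple n = begin
      2 ^ h                           ≤⟨ 2^≤central-binom h ⟩
      binom (h + h) h                 ≤⟨ m≤n*m (binom (h + h) h) (suc (h + h)) ⟩
      suc (h + h) * binom (h + h) h   ≤⟨ ∣⇒≤ {{>-nonZero D>0}} (leibniz-∣ (h + h) h (m≤m+n h h)
        (λ j j≤ → common j (≤-trans j≤ (≤-trans h+h<4h (≤-reflexive eq))))) ⟩
      D                               ≤⟨ D≤ ⟩
      suc n ^ π (suc n)               ≡⟨ cong (λ m → m ^ π m) (sym eq) ⟩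
      (2 ^ (2 + i)) ^ π (2 ^ (2 + i)) ≡⟨ ^-*-assoc 2 (2 + i) (π (2 ^ (2 + i))) ⟩
      2 ^ ((2 + i) * π (2 ^ (2 + i))) ∎
      where open ≤-Reasoning

  product-distinct-∣ : ∀ {ps n} → All Prime ps → Unique ps → (∀ {p} → p ∈ ps → p ∣ n) → product ps ∣ n
  product-distinct-∣ {[]}     []         []           hyp = 1∣ _
  product-distinct-∣ {p ∷ ps} (pp ∷ pps) (p∉ps ∷ ups) hyp = coprime-*-∣
    (prime∤⇒coprime pp (λ p∣ → All.lookup p∉ps (factorisationHasAllPrimeFactors pp p∣ pps) refl))
    (hyp (here refl)) (product-distinct-∣ pps ups (hyp ∘ there))

  ^length≤product : ∀ m xs → (∀ {x} → x ∈ xs → m ≤ x) → m ^ length xs ≤ product xs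
  ^length≤product m []       hyp = ≤-refl
  ^length≤product m (x ∷ xs) hyp = *-mono-≤ (hyp (here refl)) (^length≤product m xs (hyp ∘ there))

  prime∣!⇒≤ : ∀ {p} n → Prime p → p ∣ n ! → p ≤ n
  prime∣!⇒≤ zero    pp p∣1 = contradiction (subst Prime (∣1⇒≡1 p∣1) pp) ¬prime[1]
  prime∣!⇒≤ (suc n) pp p∣ with euclidsLemma (suc n) (n !) pp p∣
  ... | inj₁ p∣1+n = ∣⇒≤ p∣1+n
  ... | inj₂ p∣n!  = m≤n⇒m≤1+n (prime∣!⇒≤ n pp p∣n!)

  -- `p` divides (2n)! = C(2n, n) n! n!, but it is too large to divide n!.
  prime∣central-binom : ∀ {n p} → Prime p → n < p → p ≤ n + n → p ∣ binom (n + n) n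
  prime∣central-binom {n} {p} pp n<p p≤2n
    with euclidsLemma (binom (n + n) n) (n ! * n !) pp (subst (p ∣_) (sym (binom-factorial n n))
           (∣-trans (n∣n! p (prime>0 pp)) (m≤n⇒m!∣n! p≤2n)))
    where
    n∣n! : ∀ n → 0 < n → n ∣ n !
    n∣n! (suc n) _ = m∣m*n (n !)
  ... | inj₁ p∣b = p∣b
  ... | inj₂ p∣n!n! with euclidsLemma (n !) (n !) pp p∣n!n!
  ...   | inj₁ p∣n! = contradiction (prime∣!⇒≤ n pp p∣n!) (<⇒≱ n<p)
  ...   | inj₂ p∣n! = contradiction (prime∣!⇒≤ n pp p∣n!) (<⇒≱ n<p)

  -- The product of these primes, each at least `2 ^ j`, divides the central binomial coefficient of
  -- row `2 * 2 ^ j`, which is at most 2 to that power.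
  dyadic-primes : ∀ j → j * length (primesIn (2 ^ j) (2 ^ suc j)) ≤ 2 ^ suc j
  dyadic-primes j = 2^-cancel-≤ _ _ (begin
    2 ^ (j * length ps)  ≡⟨ ^-*-assoc 2 j (length ps) ⟨
    h ^ length ps        ≤⟨ ^length≤product h ps (λ p∈ → <⇒≤ (proj₁ (proj₂ (∈-primesIn⁻ p∈)))) ⟩
    product ps           ≤⟨ ∣⇒≤ {{>-nonZero (binom>0 (m≤m+n h h))}} (product-distinct-∣
      (primesIn-prime h (2 ^ suc j)) (primesIn-unique h (2 ^ suc j))
      (λ p∈ → let pp , h<p , p≤ = ∈-primesIn⁻ p∈ in
        prime∣central-binom pp h<p (≤-trans p≤ (≤-reflexive (sym (n+n≡2*n h)))))) ⟩
    binom (h + h) h      ≤⟨ binom≤2^ (h + h) h ⟩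
    2 ^ (h + h)          ≡⟨ cong (2 ^_) (n+n≡2*n h) ⟩
    2 ^ (2 ^ suc j)      ∎)
    where
    open ≤-Reasoning
    h : ℕ
    h = 2 ^ j
    ps : List ℕ
    ps = primesIn h (2 ^ suc j)

  length-primesIn-split : ∀ a b c → length (primesIn a c) ≤ length (primesIn a b) + length (primesIn b c)
  length-primesIn-split a b c = ≤-trans
    (length-⊆ {ys = primesIn a b ++ primesIn b c} (primesIn-unique a c) split)
    (≤-reflexive (length-++ (primesIn a b)))
    where
    split : ∀ {p} → p ∈ primesIn a c → p ∈ primesIn a b ++ primesIn b c
    split {p} p∈ with pp , a<p , p≤c ← ∈-primesIn⁻ p∈ with p ≤? b
    ... | yes p≤b = ∈-++⁺ˡ (∈-primesIn⁺ pp a<p p≤b)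
    ... | no p≰b  = ∈-++⁺ʳ (primesIn a b) (∈-primesIn⁺ pp (≰⇒> p≰b) p≤c)

  -- Induction over dyadic intervals. With constant C the step needs (3 + i)(C + 2) ≤ (2 + i) 2C; 6
  -- is the least C for which this holds at `i = 0`.
  chebyshev-upper : ∀ i → (2 + i) * π (2 ^ (2 + i)) ≤ 6 * 2 ^ (2 + i)
  chebyshev-upper zero    = ≤-trans (*-monoʳ-≤ 2 (length-primesIn≤ 0 4)) (m≤m+n 10 14)
  chebyshev-upper (suc i) = *-cancelˡ-≤ (2 + i) (begin
    (2 + i) * ((3 + i) * π (2 ^ (3 + i)))         ≤⟨ *-monoʳ-≤ (2 + i) (*-monoʳ-≤ (3 + i) (length-primesIn-split 0 h (2 * h))) ⟩
    (2 + i) * ((3 + i) * (π h + Δ))               ≡⟨ shuffle i (π h) Δ ⟩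
    (3 + i) * ((2 + i) * π h + (2 + i) * Δ)       ≤⟨ *-monoʳ-≤ (3 + i) (+-mono-≤ (chebyshev-upper i) (dyadic-primes (2 + i))) ⟩
    (3 + i) * (6 * h + 2 * h)                     ≤⟨ m≤m+n _ (4 * i * h) ⟩
    (3 + i) * (6 * h + 2 * h) + 4 * i * h         ≡⟨ regroup i h ⟩
    (2 + i) * (6 * (2 * h))                       ∎)
    where
    open ≤-Reasoning
    h Δ : ℕ
    h = 2 ^ (2 + i)
    Δ = length (primesIn h (2 * h))
    shuffle : ∀ i p d → (2 + i) * ((3 + i) * (p + d)) ≡ (3 + i) * ((2 + i) * p + (2 + i) * d)
    shuffle = solve-∀
    regroup : ∀ i h → (3 + i) * (6 * h + 2 * h) + 4 * i * h ≡ (2 + i) * (6 * (2 * h))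
    regroup = solve-∀

  -- Primes in (2^i, 2^(i+7)]: the lower bound 2^(i+5) beats the contribution
  -- (i + 7) π(2^i) ≤ 2 i π(2^i) ≤ 12 · 2^i of the primes up to 2^i.

  block-primes : ∀ i → 7 ≤ i → 16 * 2 ^ i ≤ (7 + i) * length (primesIn (2 ^ i) (2 ^ (7 + i)))
  block-primes i 7≤i = +-cancelˡ-≤ (12 * h) _ _ (begin
    12 * h + 16 * h                               ≤⟨ m≤m+n _ (4 * h) ⟩
    12 * h + 16 * h + 4 * h                       ≡⟨ regroup h ⟩
    2 ^ (5 + i)                                   ≤⟨ chebyshev-lower (5 + i) ⟩
    (7 + i) * π (2 ^ (7 + i))                     ≤⟨ *-monoʳ-≤ (7 + i) (length-primesIn-split 0 h (2 ^ (7 + i))) ⟩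
    (7 + i) * (π h + B)                           ≡⟨ *-distribˡ-+ (7 + i) (π h) B ⟩
    (7 + i) * π h + (7 + i) * B                   ≤⟨ +-monoˡ-≤ ((7 + i) * B) small ⟩
    12 * h + (7 + i) * B                          ∎)
    where
    open ≤-Reasoning
    h B : ℕ
    h = 2 ^ i
    B = length (primesIn h (2 ^ (7 + i)))
    regroup : ∀ h → 12 * h + 16 * h + 4 * h ≡ 2 * (2 * (2 * (2 * (2 * h))))
    regroup = solve-∀
    shifted-upper : ∀ i → 7 ≤ i → i * π (2 ^ i) ≤ 6 * 2 ^ i
    shifted-upper (suc zero)    (s≤s ())
    shifted-upper (suc (suc i)) _ = chebyshev-upper i
    small : (7 + i) * π h ≤ 12 * h
    small = begin
      (7 + i) * π h     ≤⟨ *-monoˡ-≤ (π h) (+-monoˡ-≤ i 7≤i) ⟩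
      (i + i) * π h     ≡⟨ trans (cong (_* π h) (n+n≡2*n i)) (*-assoc 2 i (π h)) ⟩
      2 * (i * π h)     ≤⟨ *-monoʳ-≤ 2 (shifted-upper i 7≤i) ⟩
      2 * (6 * h)       ≡⟨ *-assoc 2 6 h ⟨
      12 * h            ∎

-- Lower bounds for sums of reciprocals over squarefree numbers, primes and pairs.

module Reciprocals where

  open import Data.Nat.Base
  open import Data.Nat.Properties
  open ℕ-Ring using (solve-∀)
  open import Data.Nat.DivMod using (_/_; m/n*n≤m; m/n*n≡m; /-monoʳ-≤)
  open Sums
  open PairSieve
  open Chebyshev

  select : ∀ {P : Set} → Dec P → ℕ → ℕ
  select (yes _) n = n
  select (no _)  n = 0

  ∑-filter : ∀ {A : Set} {P : A → Set} (P? : ∀ x → Dec (P x)) xs f →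
             ∑ (filter P? xs) f ≡ ∑ xs (λ x → select (P? x) (f x))
  ∑-filter P? []       f = refl
  ∑-filter P? (x ∷ xs) f with P? x
  ... | yes _ = cong (f x +_) (∑-filter P? xs f)
  ... | no _  = ∑-filter P? xs f

  ∑-cartesianProductWith : ∀ {A B C : Set} (h : A → B → C) xs ys f →
    ∑ (cartesianProductWith h xs ys) f ≡ ∑ xs (λ x → ∑ ys (λ y → f (h x y)))
  ∑-cartesianProductWith h []       ys f = refl
  ∑-cartesianProductWith h (x ∷ xs) ys f = trans (∑-++ (map (h x) ys) _ f)
    (cong₂ _+_ (∑-map (h x) ys f) (∑-cartesianProductWith h xs ys f))

  infix 5 1…_

  1…_ : ℕ → List ℕ
  1… n = applyDownFrom suc n

  1…-unique : ∀ n → Unique (1… n)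
  1…-unique n = Unique.applyDownFrom⁺₁ suc n (λ j<i _ eq → <⇒≢ j<i (sym (suc-injective eq)))

  ∈-1…⁺ : ∀ {m n} → 0 < m → m ≤ n → m ∈ 1… n
  ∈-1…⁺ {suc m} _ m<n = ∈-applyDownFrom⁺ suc m<n

  ∈-1…⁻ : ∀ {m n} → m ∈ 1… n → 0 < m × m ≤ n
  ∈-1…⁻ m∈ with _ , i<n , refl ← ∈-applyDownFrom⁻ suc m∈ = z<s , i<n

  ∑-partition : ∀ {A : Set} {P : A → Set} (P? : ∀ x → Dec (P x)) xs f →
    ∑ xs f ≡ ∑ xs (λ x → select (P? x) (f x)) + ∑ xs (λ x → select (¬? (P? x)) (f x))
  ∑-partition P? []       f = refl
  ∑-partition P? (x ∷ xs) f with P? x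
  ... | yes _ = trans (cong (f x +_) (∑-partition P? xs f)) (sym (+-assoc (f x) _ _))
  ... | no _  = trans (cong (f x +_) (∑-partition P? xs f))
    (x∙yz≈y∙xz (f x) (∑ xs (λ y → select (P? y) (f y))) (∑ xs (λ y → select (¬? (P? y)) (f y))))
    where open import Algebra.Properties.CommutativeSemigroup +-commutativeSemigroup using (x∙yz≈y∙xz)

  squarefree? : ∀ n → Squarefree n ⊎ (∃[ d ] (1 < d × d * d ∣ n))
  squarefree? zero = inj₂ (2 , s≤s (s≤s z≤n) , (4 ∣0))
  squarefree? n@(suc _) with anyUpTo? (λ d → 1 <? d ×-dec d * d ∣? n) (suc n)
  ... | yes (d , _ , 1<d , dd∣) = inj₂ (d , 1<d , dd∣)
  ... | no no-square = inj₁ (λ { zero 0∣           → contradiction (0∣⇒≡0 0∣) λ ()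
                          ; (suc zero) _      → refl
                          ; d@(suc (suc _)) dd∣ → contradiction
                              (d , s≤s (≤-trans (m≤m*n d d) (∣⇒≤ dd∣)) , s≤s (s≤s z≤n) , dd∣) no-square })

  squarefree-dec : ∀ n → Dec (Squarefree n)
  squarefree-dec n with squarefree? n
  ... | inj₁ sqf             = yes sqf
  ... | inj₂ (d , 1<d , dd∣) = no (λ sqf → <⇒≢ 1<d (sym (sqf d dd∣)))

  squarefree-part : ∀ m → 0 < m → ∃[ d ] ∃[ s ] (Squarefree d × 0 < d × 0 < s × m ≡ d * (s * s))
  squarefree-part = <-rec _ step
    where
    step : ∀ m → (∀ {q} → q < m → 0 < q → ∃[ d ] ∃[ s ] (Squarefree d × 0 < d × 0 < s × q ≡ d * (s * s))) →
           0 < m → ∃[ d ] ∃[ s ] (Squarefree d × 0 < d × 0 < s × m ≡ d * (s * s))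
    step m rec 0<m with squarefree? m
    ... | inj₁ sqf = m , 1 , sqf , 0<m , z<s , sym (*-identityʳ m)
    ... | inj₂ (e , 1<e , divides zero refl) = contradiction 0<m (<-irrefl refl)
    ... | inj₂ (e , 1<e , divides q@(suc _) refl)
      with d , s , sqf , 0<d , 0<s , q≡ ← rec {q} (m<m*n q (e * e) (*-mono-< {1} {e} {1} 1<e 1<e)) z<s =
      d , s * e , sqf , 0<d , *-mono-< {0} {s} {0} 0<s (<-trans z<s 1<e) ,
      trans (cong (_* (e * e)) q≡) (regroup d s e)
      where
      regroup : ∀ d s e → d * (s * s) * (e * e) ≡ d * (s * e * (s * e))
      regroup = solve-∀

  -- ∑ 1/s² ≤ 2 - 1/t for s ≤ t, cleared of denominators.

  ∑-inverse-squares : ∀ {x : ℕ → ℕ} {R} → (∀ s → s * s * x s ≤ R) → ∀ t →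
                      suc t * ∑ (1… suc t) x + R ≤ 2 * (suc t * R)
  ∑-inverse-squares {x} {R} bound zero = +-mono-≤ {u = R} x₁≤R (≤-reflexive (sym (trans (+-identityʳ _) (+-identityʳ R))))
    where
    x₁≤R : 1 * ∑ (1… 1) x ≤ 1 * R
    x₁≤R = ≤-trans (≤-reflexive (cong (λ y → 1 * y) (+-identityʳ (x 1))))
      (≤-trans (bound 1) (≤-reflexive (sym (+-identityʳ R))))
  ∑-inverse-squares {x} {R} bound (suc t) = *-cancelˡ-≤ (1 + t) (+-cancelʳ-≤ ((2 + t) * R) _ _ (begin
    (1 + t) * ((2 + t) * (y + X) + R) + (2 + t) * R
      ≡⟨ shuffle₁ t y X R ⟩
    (2 + t) * ((1 + t) * X + R) + ((1 + t) * (2 + t) * y + (1 + t) * R)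
      ≤⟨ +-mono-≤ (*-monoʳ-≤ (2 + t) (∑-inverse-squares bound t))
          -- Telescoping: 1/s² ≤ 1/(s - 1) - 1/s with s = t + 2.
          (+-monoˡ-≤ ((1 + t) * R) (≤-trans (*-monoˡ-≤ y (*-monoˡ-≤ (2 + t) (n≤1+n (1 + t)))) (bound (2 + t)))) ⟩
    (2 + t) * (2 * ((1 + t) * R)) + (R + (1 + t) * R)
      ≡⟨ shuffle₂ t R ⟩
    (1 + t) * (2 * ((2 + t) * R)) + (2 + t) * R ∎))
    where
    open ≤-Reasoning
    y X : ℕ
    y = x (2 + t)
    X = ∑ (1… suc t) x
    shuffle₁ : ∀ t y X R → (1 + t) * ((2 + t) * (y + X) + R) + (2 + t) * R
             ≡ (2 + t) * ((1 + t) * X + R) + ((1 + t) * (2 + t) * y + (1 + t) * R)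
    shuffle₁ = solve-∀
    shuffle₂ : ∀ t R → (2 + t) * (2 * ((1 + t) * R)) + (R + (1 + t) * R) ≡ (1 + t) * (2 * ((2 + t) * R)) + (2 + t) * R
    shuffle₂ = solve-∀

  -- r n plays the role of 1/n, scaled by a common multiple M of 1, …, A.

  module Reciprocal (A M : ℕ) (common : ∀ i .{{_ : NonZero i}} → i ≤ A → i ∣ M) where

    r : ℕ → ℕ
    r zero    = 0
    r (suc n) = M / suc n

    r*≤ : ∀ n → r n * n ≤ M
    r*≤ zero    = z≤n
    r*≤ (suc n) = m/n*n≤m M (suc n)

    r*≡ : ∀ {n} → 0 < n → n ≤ A → r n * n ≡ M
    r*≡ {suc n} _ n<A = m/n*n≡m (common (suc n) n<A)

    r-antitone : ∀ n → r (2 + n) ≤ r (1 + n)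
    r-antitone n = /-monoʳ-≤ M (n≤1+n (1 + n))

    harmonic-step : ∀ X m t → t + m ≤ X → t + m ≤ A → t * M + X * ∑ (1… m) r ≤ X * ∑ (1… (t + m)) r
    harmonic-step X m zero    _   _   = ≤-refl
    harmonic-step X m (suc t) ≤X  ≤A = begin
      M + t * M + X * ∑ (1… m) r   ≡⟨ +-assoc M (t * M) _ ⟩
      M + (t * M + X * ∑ (1… m) r) ≤⟨ +-mono-≤ term (harmonic-step X m t (<⇒≤ ≤X) (<⇒≤ ≤A)) ⟩
      X * r (suc (t + m)) + X * ∑ (1… (t + m)) r ≡⟨ *-distribˡ-+ X (r (suc (t + m))) _ ⟨
      X * (r (suc (t + m)) + ∑ (1… (t + m)) r)   ∎
      where
      open ≤-Reasoning
      term : M ≤ X * r (suc (t + m))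
      term = begin
        M                                 ≡⟨ r*≡ z<s ≤A ⟨
        r (suc (t + m)) * suc (t + m)     ≤⟨ *-monoʳ-≤ (r (suc (t + m))) ≤X ⟩
        r (suc (t + m)) * X               ≡⟨ *-comm (r (suc (t + m))) X ⟩
        X * r (suc (t + m))               ∎

    -- Oresme's doubling: the `h` terms from `h + 1` to `2 * h` are each at least `M / (2 * h)`, so
    -- every doubling adds at least `M / 2`.
    harmonic : ∀ L → 2 ^ L ≤ A → L * M ≤ 2 * ∑ (1… 2 ^ L) r
    harmonic zero    _  = z≤n
    harmonic (suc L) ≤A = begin
      M + L * M                        ≤⟨ +-monoʳ-≤ M (harmonic L (≤-trans (m≤m+n h (h + 0)) ≤A)) ⟩
      M + 2 * ∑ (1… h) r               ≤⟨ *-cancelˡ-≤ h {{m^n≢0 2 L}} step ⟩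
      2 * ∑ (1… (h + h)) r             ≡⟨ cong (λ n → 2 * ∑ (1… n) r) (n+n≡2*n h) ⟩
      2 * ∑ (1… 2 * h) r               ∎
      where
      open ≤-Reasoning
      h : ℕ
      h = 2 ^ L
      shuffle₁ : ∀ h M s → h * (M + 2 * s) ≡ h * M + 2 * h * s
      shuffle₁ = solve-∀
      shuffle₂ : ∀ h s → 2 * h * s ≡ h * (2 * s)
      shuffle₂ = solve-∀
      step : h * (M + 2 * ∑ (1… h) r) ≤ h * (2 * ∑ (1… (h + h)) r)
      step = begin
        h * (M + 2 * ∑ (1… h) r)      ≡⟨ shuffle₁ h M (∑ (1… h) r) ⟩
        h * M + 2 * h * ∑ (1… h) r    ≤⟨ harmonic-step (2 * h) h h (≤-reflexive (n+n≡2*n h))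
                                           (≤-trans (≤-reflexive (n+n≡2*n h)) ≤A) ⟩
        2 * h * ∑ (1… (h + h)) r      ≡⟨ shuffle₂ h (∑ (1… (h + h)) r) ⟩
        h * (2 * ∑ (1… (h + h)) r)    ∎

    -- Consecutive numbers are not both multiples of b.

    ∑-multiples≤ : ∀ {b} → 1 < b → ∀ n →
      ∑ (1… suc n) (λ m → select (b ∣? m) (r m)) ≤ ∑ (1… n) (λ m → select (¬? (b ∣? m)) (r m))
    ∑-multiples≤ {b} 1<b zero with b ∣? 1
    ... | yes b∣1 = contradiction (sym (∣1⇒≡1 b∣1)) (<⇒≢ 1<b)
    ... | no _    = z≤n
    ∑-multiples≤ {b} 1<b (suc n) = +-mono-≤ (head (b ∣? (2 + n)) (b ∣? (1 + n))) (∑-multiples≤ 1<b n)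
      where
      head : ∀ (d : Dec (b ∣ 2 + n)) (d′ : Dec (b ∣ 1 + n)) → select d (r (2 + n)) ≤ select (¬? d′) (r (1 + n))
      head (no _)    _        = z≤n
      head (yes _)   (no _)   = r-antitone n
      head (yes b∣₂) (yes b∣₁) = contradiction
        (sym (∣1⇒≡1 (∣m+n∣m⇒∣n (subst (b ∣_) (+-comm 1 (1 + n)) b∣₂) b∣₁))) (<⇒≢ 1<b)

    ∑-nonmultiples : ∀ {b} → 1 < b → ∀ n → ∑ (1… n) r ≤ 2 * ∑ (filter (λ m → ¬? (b ∣? m)) (1… n)) r
    ∑-nonmultiples {b} 1<b zero    = z≤n
    ∑-nonmultiples {b} 1<b (suc n) = begin
      ∑ (1… suc n) r ≡⟨ ∑-partition (b ∣?_) (1… suc n) r ⟩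
      ∑ (1… suc n) (λ m → select (b ∣? m) (r m)) + N ≤⟨ +-monoˡ-≤ N (≤-trans (∑-multiples≤ 1<b n) (m≤n+m _ (select (¬? (b ∣? suc n)) (r (suc n))))) ⟩
      N + N          ≡⟨ n+n≡2*n N ⟩
      2 * N          ≡⟨ cong (2 *_) (∑-filter (λ m → ¬? (b ∣? m)) (1… suc n) r) ⟨
      2 * ∑ (filter (λ m → ¬? (b ∣? m)) (1… suc n)) r ∎
      where
      open ≤-Reasoning
      N : ℕ
      N = ∑ (1… suc n) (λ m → select (¬? (b ∣? m)) (r m))

    squarefrees : List ℕ
    squarefrees = filter squarefree-dec (1… A)

    ∈-squarefrees⁻ : ∀ {a} → a ∈ squarefrees → Squarefree a × 0 < a × a ≤ A
    ∈-squarefrees⁻ a∈ with a∈1…A , sqf ← ∈-filter⁻ squarefree-dec {xs = 1… A} a∈ = sqf , ∈-1…⁻ a∈1…A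

    -- `d * (s * s)` may exceed `A`, where `r` is only a quotient rounded down; `r n * n ≤ M` holds
    -- there too, while `r d * d ≡ M` is exact because `d ≤ A`.
    r-square : ∀ {d} → 0 < d → d ≤ A → ∀ s → s * s * r (d * (s * s)) ≤ r d
    r-square {d} 0<d d≤A s = *-cancelˡ-≤ d {{>-nonZero 0<d}} (begin
      d * (s * s * r (d * (s * s)))   ≡⟨ trans (sym (*-assoc d (s * s) _)) (*-comm (d * (s * s)) _) ⟩
      r (d * (s * s)) * (d * (s * s)) ≤⟨ r*≤ (d * (s * s)) ⟩
      M                               ≡⟨ trans (*-comm d (r d)) (r*≡ 0<d d≤A) ⟨
      d * r d                         ∎)
      where open ≤-Reasoning

    ∑-squares≤ : ∀ {d} → 0 < d → d ≤ A → ∀ t → ∑ (1… t) (λ s → r (d * (s * s))) ≤ 2 * r d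
    ∑-squares≤ 0<d d≤A zero    = z≤n
    ∑-squares≤ {d} 0<d d≤A (suc t) = *-cancelˡ-≤ (suc t) (begin
      suc t * ∑ (1… suc t) x            ≤⟨ m≤m+n _ (r d) ⟩
      suc t * ∑ (1… suc t) x + r d      ≤⟨ ∑-inverse-squares {x} (r-square 0<d d≤A) t ⟩
      2 * (suc t * r d)                 ≡⟨ shuffle t (r d) ⟩
      suc t * (2 * r d)                 ∎)
      where
      open ≤-Reasoning
      x : ℕ → ℕ
      x s = r (d * (s * s))
      shuffle : ∀ t R → 2 * (suc t * R) ≡ suc t * (2 * R)
      shuffle = solve-∀

    -- Every `m` is `d * (s * s)` with `d` squarefree, and `b ∤ m` passes to `d`. So the sum is at
    -- most the squarefree one times the sum of 1/s², which is below 2.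
    ∑-squarefree : ∀ b → ∑ (filter (λ m → ¬? (b ∣? m)) (1… A)) r
                       ≤ 2 * ∑ (filter (λ a → ¬? (b ∣? a)) squarefrees) r
    ∑-squarefree b = begin
      ∑ (filter b∤? (1… A)) r         ≤⟨ ∑-⊆ r (Unique.filter⁺ b∤? (1…-unique A)) factor ⟩
      ∑ (cartesianProductWith (λ d s → d * (s * s)) D (1… A)) r ≡⟨ ∑-cartesianProductWith (λ d s → d * (s * s)) D (1… A) r ⟩
      ∑ D (λ d → ∑ (1… A) (λ s → r (d * (s * s)))) ≤⟨ ∑-mono D (λ d d∈ →
        let _ , 0<d , d≤A = ∈-squarefrees⁻ (proj₁ (∈-filter⁻ b∤? {xs = squarefrees} d∈)) in
        ≤-trans (∑-squares≤ 0<d d≤A A) (≤-reflexive (*-comm 2 (r d)))) ⟩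
      ∑ D (λ d → r d * 2)             ≡⟨ trans (∑-*ʳ D r 2) (*-comm (∑ D r) 2) ⟩
      2 * ∑ D r                       ∎
      where
      open ≤-Reasoning
      b∤? : ∀ m → Dec (¬ b ∣ m)
      b∤? m = ¬? (b ∣? m)
      D : List ℕ
      D = filter b∤? squarefrees
      factor : ∀ {m} → m ∈ filter b∤? (1… A) → m ∈ cartesianProductWith (λ d s → d * (s * s)) D (1… A)
      factor m∈ with m∈1…A , b∤m ← ∈-filter⁻ b∤? {xs = 1… A} m∈
        with 0<m , m≤A ← ∈-1…⁻ m∈1…A
        with d , s , sqf , 0<d , 0<s , refl ← squarefree-part _ 0<m = ∈-cartesianProductWith⁺ (λ d s → d * (s * s))
          (∈-filter⁺ b∤? (∈-filter⁺ squarefree-dec (∈-1…⁺ 0<d (≤-trans (m≤m*n d (s * s) {{ss≢0}}) m≤A)) sqf)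
            (λ b∣d → b∤m (∣m⇒∣m*n (s * s) b∣d)))
          (∈-1…⁺ 0<s (≤-trans (≤-trans (m≤m*n s s {{>-nonZero 0<s}}) (m≤n*m (s * s) d {{>-nonZero 0<d}})) m≤A))
        where
        ss≢0 : NonZero (s * s)
        ss≢0 = m*n≢0 s s {{>-nonZero 0<s}} {{>-nonZero 0<s}}

    -- The constant 8 is a product of three losses of 2: in the harmonic sum, in dropping the
    -- multiples of `b`, and in passing to squarefree numbers.
    squarefree-sum : ∀ {b L} → 1 < b → 2 ^ L ≡ A → L * M ≤ 8 * ∑ (filter (λ a → ¬? (b ∣? a)) squarefrees) r
    squarefree-sum {b} {L} 1<b refl = begin
      L * M                     ≤⟨ harmonic L ≤-refl ⟩
      2 * ∑ (1… A) r            ≤⟨ *-monoʳ-≤ 2 (∑-nonmultiples 1<b A) ⟩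
      2 * (2 * ∑ (filter (λ m → ¬? (b ∣? m)) (1… A)) r) ≤⟨ *-monoʳ-≤ 2 (*-monoʳ-≤ 2 (∑-squarefree b)) ⟩
      2 * (2 * (2 * X))         ≡⟨ shuffle X ⟩
      8 * X                     ∎
      where
      open ≤-Reasoning
      X : ℕ
      X = ∑ (filter (λ a → ¬? (b ∣? a)) squarefrees) r
      shuffle : ∀ x → 2 * (2 * (2 * x)) ≡ 8 * x
      shuffle = solve-∀

    ∑-primes : ℕ → ℕ → ℕ
    ∑-primes x y = ∑ (primesIn x y) r

    ∑-primes-split : ∀ {x y z} → x ≤ y → y ≤ z → ∑-primes x y + ∑-primes y z ≤ ∑-primes x z
    ∑-primes-split {x} {y} {z} x≤y y≤z = ≤-trans (≤-reflexive (sym (∑-++ (primesIn x y) (primesIn y z) r)))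
      (∑-⊆ r (Unique.++⁺ (primesIn-unique x y) (primesIn-unique y z) disjoint) merge)
      where
      disjoint : ∀ {p} → ¬ (p ∈ primesIn x y × p ∈ primesIn y z)
      disjoint (p∈₁ , p∈₂) = <⇒≱ (proj₁ (proj₂ (∈-primesIn⁻ p∈₂))) (proj₂ (proj₂ (∈-primesIn⁻ p∈₁)))
      merge : ∀ {p} → p ∈ primesIn x y ++ primesIn y z → p ∈ primesIn x z
      merge p∈ with ∈-++⁻ (primesIn x y) p∈
      ... | inj₁ p∈₁ = let pp , x<p , p≤y = ∈-primesIn⁻ p∈₁ in ∈-primesIn⁺ pp x<p (≤-trans p≤y y≤z)
      ... | inj₂ p∈₂ = let pp , y<p , p≤z = ∈-primesIn⁻ p∈₂ in ∈-primesIn⁺ pp (≤-<-trans x≤y y<p) p≤z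

    -- The block holds at least 16 h / (7 + i) primes with `h = 2 ^ i`, and none exceeds 128 h; the
    -- constant 8 is 128 / 16.
    block-sum : ∀ i → 7 ≤ i → 2 ^ (7 + i) ≤ A → M ≤ 8 * (7 + i) * ∑-primes (2 ^ i) (2 ^ (7 + i))
    block-sum i 7≤i ≤A = *-cancelˡ-≤ (16 * h) {{m*n≢0 16 h {{_}} {{m^n≢0 2 i}}}} (begin
      16 * h * M                      ≤⟨ *-monoˡ-≤ M (block-primes i 7≤i) ⟩
      (7 + i) * length ps * M         ≡⟨ *-assoc (7 + i) (length ps) M ⟩
      (7 + i) * (length ps * M)       ≡⟨ cong ((7 + i) *_) (sym (∑-const ps M)) ⟩
      (7 + i) * ∑ ps (λ _ → M)        ≤⟨ *-monoʳ-≤ (7 + i) (∑-mono ps (λ b b∈ →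
        let pb , _ , b≤ = ∈-primesIn⁻ b∈ in
        ≤-trans (≤-reflexive (sym (r*≡ (prime>0 pb) (≤-trans b≤ ≤A)))) (*-monoʳ-≤ (r b) b≤))) ⟩
      (7 + i) * ∑ ps (λ b → r b * X)  ≡⟨ cong ((7 + i) *_) (∑-*ʳ ps r X) ⟩
      (7 + i) * (∑ ps r * X)          ≡⟨ shuffle (7 + i) (∑ ps r) h ⟩
      16 * h * (8 * (7 + i) * ∑ ps r) ∎)
      where
      open ≤-Reasoning
      h X : ℕ
      h = 2 ^ i
      X = 2 ^ (7 + i)
      ps : List ℕ
      ps = primesIn h X
      shuffle : ∀ j s h → j * (s * (2 * (2 * (2 * (2 * (2 * (2 * (2 * h)))))))) ≡ 16 * h * (8 * j * s)
      shuffle = solve-∀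

    -- Exponents are multiples of 7, so that the intervals are made up of the blocks treated in
    -- `block-primes`.
    S : ℕ → ℕ → ℕ
    S u v = ∑-primes (2 ^ (7 * u)) (2 ^ (7 * v))

    2^7*-mono : ∀ {u v} → u ≤ v → 2 ^ (7 * u) ≤ 2 ^ (7 * v)
    2^7*-mono u≤v = ^-monoʳ-≤ 2 (*-monoʳ-≤ 7 u≤v)

    S-step : ∀ {u} → 0 < u → 2 ^ (7 * suc u) ≤ A → M ≤ 56 * suc u * S u (suc u)
    S-step {u} 0<u ≤A = subst (λ i → M ≤ i * S u (suc u)) (sym (*-assoc 8 7 (suc u)))
      (subst (λ i → M ≤ 8 * i * ∑-primes (2 ^ (7 * u)) (2 ^ i)) (sym (*-suc 7 u))
        (block-sum (7 * u) (m≤m*n 7 u {{>-nonZero 0<u}}) (subst (λ i → 2 ^ i ≤ A) (*-suc 7 u) ≤A)))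

    -- As `t ≤ u`, each block of the run ends at an exponent of at most `7 * (2 * u)` and so
    -- contributes at least `M / (112 * u)`. A full run of `u` blocks gives `M / 112`.
    S-run : ∀ {u} → 0 < u → ∀ t → t ≤ u → 2 ^ (7 * (t + u)) ≤ A → t * M ≤ 112 * u * S u (t + u)
    S-run 0<u zero    _   _  = z≤n
    S-run {u} 0<u (suc t) t<u ≤A = begin
      M + t * M                                         ≤⟨ +-mono-≤
        (≤-trans (S-step (≤-trans 0<u (m≤n+m u t)) ≤A)
          (*-monoˡ-≤ (S (t + u) (suc (t + u)))
            (≤-trans (*-monoʳ-≤ 56 (+-monoˡ-≤ u t<u)) (≤-reflexive (double u)))))
        (S-run 0<u t (<⇒≤ t<u) (≤-trans (2^7*-mono (n≤1+n (t + u))) ≤A)) ⟩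
      112 * u * S (t + u) (suc (t + u)) + 112 * u * S u (t + u) ≡⟨ regroup (112 * u) _ _ ⟩
      112 * u * (S u (t + u) + S (t + u) (suc (t + u))) ≤⟨ *-monoʳ-≤ (112 * u)
        (∑-primes-split (2^7*-mono (m≤n+m u t)) (2^7*-mono (n≤1+n (t + u)))) ⟩
      112 * u * S u (suc (t + u))                       ∎
      where
      open ≤-Reasoning
      double : ∀ u → 56 * (u + u) ≡ 112 * u
      double = solve-∀
      regroup : ∀ c a b → c * a + c * b ≡ c * (b + a)
      regroup = solve-∀

    S-double : ∀ {u} → 0 < u → 2 ^ (7 * (u + u)) ≤ A → M ≤ 112 * S u (u + u)
    S-double {u} 0<u ≤A = *-cancelˡ-≤ u {{>-nonZero 0<u}}
      (≤-trans (S-run 0<u u ≤-refl ≤A) (≤-reflexive (shuffle u (S u (u + u)))))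
      where
      shuffle : ∀ u s → 112 * u * s ≡ u * (112 * s)
      shuffle = solve-∀

    -- The log log growth of the sum of 1/p in discrete form: each doubling of the exponent adds at
    -- least 1/112, whatever the starting point.
    prime-sum : ∀ {u} → 0 < u → ∀ ρ → 2 ^ (7 * (2 ^ ρ * u)) ≤ A → ρ * M ≤ 112 * S u (2 ^ ρ * u)
    prime-sum 0<u zero    _  = z≤n
    prime-sum {u} 0<u (suc ρ) ≤A = begin
      M + ρ * M                                   ≤⟨ +-mono-≤
        (S-double {v} (*-mono-≤ (m^n>0 2 ρ) 0<u) (subst (λ w → 2 ^ (7 * w) ≤ A) (sym v+v) ≤A))
        (prime-sum 0<u ρ (≤-trans (2^7*-mono v≤2v) ≤A)) ⟩
      112 * S v (v + v) + 112 * S u v             ≡⟨ regroup (S v (v + v)) (S u v) ⟩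
      112 * (S u v + S v (v + v))                 ≤⟨ *-monoʳ-≤ 112 (∑-primes-split
        (2^7*-mono {u} {v} (m≤n*m u (2 ^ ρ) {{m^n≢0 2 ρ}})) (2^7*-mono {v} {v + v} (m≤m+n v v))) ⟩
      112 * S u (v + v)                           ≡⟨ cong (λ w → 112 * S u w) {v + v} {2 ^ suc ρ * u} v+v ⟩
      112 * S u (2 ^ suc ρ * u)                   ∎
      where
      open ≤-Reasoning
      v : ℕ
      v = 2 ^ ρ * u
      v+v : v + v ≡ 2 ^ suc ρ * u
      v+v = trans (n+n≡2*n v) (sym (*-assoc 2 (2 ^ ρ) u))
      v≤2v : v ≤ 2 ^ suc ρ * u
      v≤2v = ≤-trans (m≤m+n v v) (≤-reflexive v+v)
      regroup : ∀ a b → 112 * a + 112 * b ≡ 112 * (b + a)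
      regroup = solve-∀

    pairs : List ℕ → List (ℕ × ℕ)
    pairs bs = filter (λ i → ¬? (proj₂ i ∣? proj₁ i)) (cartesianProductWith (λ b a → (a , b)) bs squarefrees)

    weight : ℕ × ℕ → ℕ
    weight (a , b) = r a * r b

    pairs-unique : ∀ {bs} → Unique bs → Unique (pairs bs)
    pairs-unique ubs = Unique.filter⁺ (λ i → ¬? (proj₂ i ∣? proj₁ i))
      (Unique.cartesianProductWith⁺ (λ b a → (a , b)) (λ eq → cong proj₂ eq , cong proj₁ eq) ubs
        (Unique.filter⁺ squarefree-dec (1…-unique A)))

    ∈-pairs⁻ : ∀ {bs a b} → (a , b) ∈ pairs bs → b ∈ bs × a ∈ squarefrees × ¬ b ∣ a
    ∈-pairs⁻ {bs} i∈ with i∈product , b∤a ← ∈-filter⁻ (λ i → ¬? (proj₂ i ∣? proj₁ i))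
                             {xs = cartesianProductWith (λ b a → (a , b)) bs squarefrees} i∈
      with _ , _ , b∈ , a∈ , refl ← ∈-cartesianProductWith⁻ (λ b a → (a , b)) bs squarefrees i∈product = b∈ , a∈ , b∤a

    pairs-sum : ∀ {L} bs → (∀ {b} → b ∈ bs → 1 < b) → 2 ^ L ≡ A →
                ∑ bs r * (L * M) ≤ 8 * ∑ (pairs bs) weight
    pairs-sum {L} bs 1<bs 2^L≡A = begin
      ∑ bs r * (L * M)                ≡⟨ ∑-*ʳ bs r (L * M) ⟨
      ∑ bs (λ b → r b * (L * M))      ≤⟨ ∑-mono bs (λ b b∈ → inner b (1<bs b∈)) ⟩
      ∑ bs (λ b → ∑ squarefrees (λ a → select (¬? (b ∣? a)) (r a * r b)) * 8) ≡⟨ ∑-*ʳ bs _ 8 ⟩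
      ∑ bs (λ b → ∑ squarefrees (λ a → select (¬? (b ∣? a)) (r a * r b))) * 8
        ≡⟨ *-comm (∑ bs (λ b → ∑ squarefrees (λ a → select (¬? (b ∣? a)) (r a * r b)))) 8 ⟩
      8 * ∑ bs (λ b → ∑ squarefrees (λ a → select (¬? (b ∣? a)) (r a * r b))) ≡⟨ cong (8 *_) (trans
        (∑-filter (λ i → ¬? (proj₂ i ∣? proj₁ i)) (cartesianProductWith (λ b a → (a , b)) bs squarefrees) weight)
        (∑-cartesianProductWith (λ b a → (a , b)) bs squarefrees (λ i → select (¬? (proj₂ i ∣? proj₁ i)) (weight i)))) ⟨
      8 * ∑ (pairs bs) weight         ∎
      where
      open ≤-Reasoning
      inner : ∀ b → 1 < b → r b * (L * M) ≤ ∑ squarefrees (λ a → select (¬? (b ∣? a)) (r a * r b)) * 8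
      inner b 1<b = begin
        r b * (L * M)                 ≤⟨ *-monoʳ-≤ (r b) (squarefree-sum {b} {L} 1<b 2^L≡A) ⟩
        r b * (8 * ∑ D r)             ≡⟨ shuffle (r b) (∑ D r) ⟩
        ∑ D r * r b * 8               ≡⟨ cong (_* 8) (∑-*ʳ D r (r b)) ⟨
        ∑ D (λ a → r a * r b) * 8     ≡⟨ cong (_* 8) (∑-filter (λ a → ¬? (b ∣? a)) squarefrees (λ a → r a * r b)) ⟩
        ∑ squarefrees (λ a → select (¬? (b ∣? a)) (r a * r b)) * 8 ∎
        where
        D : List ℕ
        D = filter (λ a → ¬? (b ∣? a)) squarefrees
        shuffle : ∀ x s → x * (8 * s) ≡ s * x * 8
        shuffle = solve-∀

-- Choice of parameters and the count of primes `p` with a large prime factor of `p - 1`.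

module RoughPrimes where

  open import Data.Nat.Base
  open import Data.Nat.Properties
  open ℕ-Ring using (solve-∀)
  open import Data.Nat.DivMod using (_/_; _%_; m≡m%n+[m/n]*n; m%n<n; m/n*n≤m; m≥n⇒m/n>0)
  open Sums
  open Local
  open PairSieve
  open Chebyshev
  open Reciprocals

  module _ (ρ u : ℕ) (0<ρ : 0 < ρ) (0<u : 0 < u) where

    -- `A` is `y` to the power `2 ^ ρ`. So `ρ` fixes the ratio of the logarithms, and with it the
    -- gain, while `u` adapts the size to `N`.
    L A y : ℕ
    L = 7 * (2 ^ ρ * u)
    A = 2 ^ L
    y = 2 ^ (7 * u)

    L>0 : 0 < L
    L>0 = *-mono-≤ {1} {7} (s≤s z≤n) (*-mono-≤ (m^n>0 2 ρ) 0<u)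

    A>0 : 0 < A
    A>0 = m^n>0 2 L

    Sifted : ℕ → Set
    Sifted k = (∀ {p} → Prime p → p ≤ A → ¬ p ∣ suc k) × (∀ {b} → Prime b → y < b → b ≤ A → ¬ b ∣ k)

    private
      M : ℕ
      -- Any common multiple of 1, ..., A would do; its square cancels in `sifted-count`.
      M = A !

      M>0 : 0 < M
      M>0 = m≤n⇒m≤n! A
        where
        m≤n⇒m≤n! : ∀ n → 0 < n !
        m≤n⇒m≤n! n = >-nonZero⁻¹ (n !) {{n !≢0}}

      divides-! : ∀ i .{{_ : NonZero i}} → i ≤ A → i ∣ M
      divides-! i@(suc i₋) i≤A = ∣-trans (m∣m*n (i₋ !)) (m≤n⇒m!∣n! i≤A)

      open Reciprocal A M divides-!

      bs ps : List ℕ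
      bs = primesIn y A
      ps = primesIn 0 A

      G : ℕ
      G = ∑ (pairs bs) weight

      -- Without the scaling: the sum of 1/(a b) over the pairs is at least ρ L / 896, where L is
      -- the binary logarithm of `A` and 896 = 112 · 8 combines `prime-sum` and `pairs-sum`.
      ρLMM≤G : ρ * L * (M * M) ≤ 896 * G
      ρLMM≤G = begin
        ρ * L * (M * M)             ≡⟨ shuffle₁ ρ L M ⟩
        ρ * M * (L * M)             ≤⟨ *-monoˡ-≤ (L * M) (prime-sum 0<u ρ ≤-refl) ⟩
        112 * ∑ bs r * (L * M)      ≡⟨ *-assoc 112 (∑ bs r) (L * M) ⟩
        112 * (∑ bs r * (L * M))    ≤⟨ *-monoʳ-≤ 112 (pairs-sum {L} bs (λ b∈ → prime>1 (proj₁ (∈-primesIn⁻ b∈))) refl) ⟩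
        112 * (8 * G)               ≡⟨ *-assoc 112 8 G ⟨
        896 * G                     ∎
        where
        open ≤-Reasoning
        shuffle₁ : ∀ ρ L M → ρ * L * (M * M) ≡ ρ * M * (L * M)
        shuffle₁ = solve-∀

      instance
        MM≢0 : NonZero (M * M)
        MM≢0 = >-nonZero (*-mono-≤ M>0 M>0)
        G≢0 : NonZero G
        G≢0 = ≢-nonZero (λ G≡0 → <⇒≱ (*-mono-≤ (*-mono-≤ 0<ρ L>0) (*-mono-≤ M>0 M>0))
          (≤-trans ρLMM≤G (≤-reflexive (trans (cong (896 *_) G≡0) (*-zeroʳ 896)))))
        AA≢0 : NonZero (A * A)
        AA≢0 = >-nonZero (*-mono-≤ A>0 A>0)

      -- The error of `pair-sieve` for `Q = A * A`, that is, the twelfth power of `A`.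
      E : ℕ
      E = (A * A * (A * A)) * ((A * A * (A * A)) * (A * A * (A * A)))

      pairs-small : ∀ {N} → All (Small (primesIn-prime 0 A) (primesIn-unique 0 A) weight N (M * M) (A * A)) (pairs bs)
      pairs-small = All.tabulate small
        where
        small : ∀ {i} → i ∈ pairs bs → _
        small {a , b} i∈ =
          record { a≢0 = >-nonZero 0<a ; squarefree = sqf ; b∈ps = ∈-primesIn⁺ pb (prime>0 pb) b≤A ; b∤a = b∤a
                 ; support = λ p pp p∣a → ∈-primesIn⁺ pp (prime>0 pp) (≤-trans (∣⇒≤ {{>-nonZero 0<a}} p∣a) a≤A) } ,
          *-mono-≤ a≤A b≤A ,
          ≤-reflexive (trans (shuffle (r a) (r b) a b) (cong₂ _*_ (r*≡ 0<a a≤A) (r*≡ (prime>0 pb) b≤A)))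
          where
          parts : b ∈ bs × a ∈ squarefrees × ¬ b ∣ a
          parts = ∈-pairs⁻ i∈
          b-facts : Prime b × y < b × b ≤ A
          b-facts = ∈-primesIn⁻ (proj₁ parts)
          a-facts : Squarefree a × 0 < a × a ≤ A
          a-facts = ∈-squarefrees⁻ (proj₁ (proj₂ parts))
          b∤a : ¬ b ∣ a
          b∤a = proj₂ (proj₂ parts)
          pb : Prime b
          pb = proj₁ b-facts
          b≤A : b ≤ A
          b≤A = proj₂ (proj₂ b-facts)
          sqf : Squarefree a
          sqf = proj₁ a-facts
          0<a : 0 < a
          0<a = proj₁ (proj₂ a-facts)
          a≤A : a ≤ A
          a≤A = proj₂ (proj₂ a-facts)
          shuffle : ∀ x y a b → x * y * (a * b) ≡ x * a * (y * b)
          shuffle = solve-∀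

    -- The sieve bound has `G` on both sides, so a lower bound for `G` can be inserted only after
    -- `E * G` has moved to the left. Hence the detour through `length xs ∸ E`.
    sifted-count : ∀ {N xs} → Unique xs → All (_< N) xs → All Sifted xs →
                   length xs * (ρ * L) ≤ 896 * N + 2 ^ (12 * L) * (ρ * L)
    sifted-count {N} {xs} uxs xs<N sifted = *-cancelʳ-≤ _ _ (M * M) (begin
      length xs * (ρ * L) * (M * M)           ≤⟨ *-monoˡ-≤ (M * M) (*-monoˡ-≤ (ρ * L) (m≤n+m∸n (length xs) E)) ⟩
      (E + (length xs ∸ E)) * (ρ * L) * (M * M) ≡⟨ shuffle₁ E (length xs ∸ E) (ρ * L) (M * M) ⟩
      (length xs ∸ E) * (ρ * L * (M * M)) + E * (ρ * L) * (M * M)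
        ≤⟨ +-monoˡ-≤ (E * (ρ * L) * (M * M)) (*-monoʳ-≤ (length xs ∸ E) ρLMM≤G) ⟩
      (length xs ∸ E) * (896 * G) + E * (ρ * L) * (M * M)
        ≡⟨ cong (_+ E * (ρ * L) * (M * M)) (shuffle₂ (length xs ∸ E) 896 G) ⟩
      896 * ((length xs ∸ E) * G) + E * (ρ * L) * (M * M)
        ≤⟨ +-monoˡ-≤ (E * (ρ * L) * (M * M)) (*-monoʳ-≤ 896 excess) ⟩
      896 * (N * (M * M)) + E * (ρ * L) * (M * M) ≡⟨ shuffle₃ 896 N (M * M) (E * (ρ * L)) ⟩
      (896 * N + E * (ρ * L)) * (M * M)       ≡⟨ cong (λ e → (896 * N + e * (ρ * L)) * (M * M)) E≡ ⟩
      (896 * N + 2 ^ (12 * L) * (ρ * L)) * (M * M) ∎)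
      where
      open ≤-Reasoning
      shuffle₁ : ∀ e d x m → (e + d) * x * m ≡ d * (x * m) + e * x * m
      shuffle₁ = solve-∀
      shuffle₂ : ∀ d c g → d * (c * g) ≡ c * (d * g)
      shuffle₂ = solve-∀
      shuffle₃ : ∀ c n m e → c * (n * m) + e * m ≡ (c * n + e) * m
      shuffle₃ = solve-∀
      E≡ : E ≡ 2 ^ (12 * L)
      E≡ = trans (cong₂ _*_ fourth (trans (cong₂ _*_ fourth fourth) (add L₄ L₄)))
        (trans (add L₄ (L₄ + L₄)) (cong (2 ^_) (exponent L)))
        where
        L₄ : ℕ
        L₄ = L + L + (L + L)
        add : ∀ m n → 2 ^ m * 2 ^ n ≡ 2 ^ (m + n)
        add m n = sym (^-distribˡ-+-* 2 m n)
        fourth : A * A * (A * A) ≡ 2 ^ L₄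
        fourth = trans (cong₂ _*_ (add L L) (add L L)) (add (L + L) (L + L))
        exponent : ∀ l → (l + l + (l + l)) + ((l + l + (l + l)) + (l + l + (l + l))) ≡ 12 * l
        exponent = solve-∀
      excess : (length xs ∸ E) * G ≤ N * (M * M)
      excess = ≤-trans (≤-reflexive (*-distribʳ-∸ G (length xs) E))
        (m≤n+o⇒m∸n≤o (length xs * G) (E * G) (≤-trans
          (pair-sieve (primesIn-prime 0 A) (primesIn-unique 0 A) weight N (M * M) (A * A) (pairs bs) xs
            (pairs-unique (primesIn-unique y A)) (pairs-small {N}) uxs xs<N
            (All.map (λ (p∤ , b∤) →
                (λ p p∈ → let pp , _ , p≤A = ∈-primesIn⁻ p∈ in p∤ pp p≤A) ,
                All.tabulate (λ { {a , b} i∈ → let pb , y<b , b≤A = ∈-primesIn⁻ (proj₁ (∈-pairs⁻ i∈)) in b∤ pb y<b b≤A }))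
              sifted))
          (≤-reflexive (+-comm (N * (M * M)) (E * G)))))

  π-mono : ∀ {m n} → m ≤ n → π m ≤ π n
  π-mono m≤n = length-⊆ (primesIn-unique 0 _)
    (λ p∈ → let pp , 0<p , p≤m = ∈-primesIn⁻ p∈ in ∈-primesIn⁺ pp 0<p (≤-trans p≤m m≤n))

  dyadic : ∀ N → 0 < N → ∃[ j ] (2 ^ j ≤ N × N < 2 ^ suc j)
  dyadic (suc N) _ = floor-log 2 (suc N) , ^floor-log≤ 2 N , <^1+floor-log (s≤s (s≤s z≤n)) (suc N)

  chebyshev : ∀ {N j} → 2 ≤ j → 2 ^ j ≤ N → N < 2 ^ suc j → suc N ≤ 8 * (j * π N)
  chebyshev {N} {suc (suc i)} _ ≤N N< = begin
    suc N                               ≤⟨ N< ⟩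
    2 ^ (3 + i)                         ≡⟨ shuffle (2 ^ i) ⟩
    8 * 2 ^ i                           ≤⟨ *-monoʳ-≤ 8 (chebyshev-lower i) ⟩
    8 * ((2 + i) * π (2 ^ (2 + i)))     ≤⟨ *-monoʳ-≤ 8 (*-monoʳ-≤ (2 + i) (π-mono ≤N)) ⟩
    8 * ((2 + i) * π N)                 ∎
    where
    open ≤-Reasoning
    shuffle : ∀ h → 2 * (2 * (2 * h)) ≡ 8 * h
    shuffle = solve-∀
  chebyshev {j = suc zero} (s≤s ()) _ _

  ^-cancelˡ-< : ∀ n {a b} → a ^ n < b ^ n → a < b
  ^-cancelˡ-< n {a} {b} lt = ≰⇒> (λ b≤a → <⇒≱ lt (^-monoˡ-≤ n b≤a))

  ^-distribʳ-* : ∀ n a b → (a * b) ^ n ≡ a ^ n * b ^ n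
  ^-distribʳ-* zero    a b = refl
  ^-distribʳ-* (suc n) a b = trans (cong (a * b *_) (^-distribʳ-* n a b)) ([m*n]*[o*p]≡[m*o]*[n*p] a b (a ^ n) (b ^ n))

  n≤2^n : ∀ n → n ≤ 2 ^ n
  n≤2^n zero    = z≤n
  n≤2^n (suc n) = +-mono-≤ (m^n>0 2 n) (≤-trans (n≤2^n n) (m≤m+n (2 ^ n) 0))

  -- p = k + 1 is a prime with P⁺(p - 1) ≥ p^(1 - 1/(K+1)); q stands for P⁺(p - 1).

  record Rough (K k : ℕ) : Set where
    field
      1+k-prime : Prime (suc k)
      q     : ℕ
      q∣k   : q ∣ k
      q-prime : q ≡ 1 ⊎ Prime q
      large : suc k ^ K ≤ q ^ suc K

  module _ (ρ u K : ℕ) (0<ρ : 0 < ρ) (0<u : 0 < u) (0<K : 0 < K) where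

    private
      A₀ y₀ : ℕ
      A₀ = A ρ u 0<ρ 0<u
      y₀ = y ρ u 0<ρ 0<u

      A₀>0 : 0 < A₀
      A₀>0 = A>0 ρ u 0<ρ 0<u

    -- If `q ≤ A₀`, then `q ^ (K + 1)` is at most `(A₀ * A₀) ^ K ≤ k ^ K`, against `large`. For
    -- `k = c * q`, `large` also gives `c ^ (K + 1) < k + 1 ≤ y₀ ^ (K + 1)`. So a prime in (y₀, A₀]
    -- is too big to divide `c` and too small to be `q`; and `k + 1` is itself a prime above `A₀`.
    rough⇒sifted : ∀ {k} → Rough K k → A₀ * A₀ ≤ k → suc k ≤ y₀ ^ suc K → Sifted ρ u 0<ρ 0<u k
    rough⇒sifted {k} rough AA≤k 1+k≤ = p∤1+k , b∤k
      where
      open Rough rough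
      A≤AA : A₀ ≤ A₀ * A₀
      A≤AA = m≤m*n A₀ A₀ {{>-nonZero A₀>0}}
      0<k : 0 < k
      0<k = ≤-trans (*-mono-≤ A₀>0 A₀>0) AA≤k
      p∤1+k : ∀ {p} → Prime p → p ≤ A₀ → ¬ p ∣ suc k
      p∤1+k pp p≤A p∣ = <⇒≱ (s≤s (≤-trans (≤-trans p≤A A≤AA) AA≤k)) (≤-reflexive (sym (prime∣prime⇒≡ pp 1+k-prime p∣)))
      A<q : A₀ < q
      A<q = ≰⇒> (λ q≤A → <⇒≱ (begin-strict
        q ^ suc K               ≤⟨ ^-monoˡ-≤ (suc K) q≤A ⟩
        A₀ ^ suc K              ≤⟨ ^-monoʳ-≤ A₀ {{>-nonZero A₀>0}} (+-monoˡ-≤ K 0<K) ⟩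
        A₀ ^ (K + K)            ≡⟨ ^-distribˡ-+-* A₀ K K ⟩
        A₀ ^ K * A₀ ^ K         ≡⟨ ^-distribʳ-* K A₀ A₀ ⟨
        (A₀ * A₀) ^ K           ≤⟨ ^-monoˡ-≤ K AA≤k ⟩
        k ^ K                   <⟨ ^-monoˡ-< K {{>-nonZero 0<K}} (n<1+n k) ⟩
        suc k ^ K               ∎) large)
        where open ≤-Reasoning
      cofactor<y : ∀ c → k ≡ c * q → c < y₀
      cofactor<y c k≡cq = ^-cancelˡ-< (suc K) (<-≤-trans (*-cancelʳ-< (q ^ suc K) (c ^ suc K) (suc k) (begin-strict
        c ^ suc K * q ^ suc K   ≡⟨ ^-distribʳ-* (suc K) c q ⟨
        (c * q) ^ suc K         ≡⟨ cong (_^ suc K) (sym k≡cq) ⟩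
        k ^ suc K               <⟨ ^-monoˡ-< (suc K) (n<1+n k) ⟩
        suc k ^ suc K           ≤⟨ *-monoʳ-≤ (suc k) large ⟩
        suc k * q ^ suc K       ∎)) 1+k≤)
        where open ≤-Reasoning
      b∤k : ∀ {b} → Prime b → y₀ < b → b ≤ A₀ → ¬ b ∣ k
      b∤k {b} pb y<b b≤A b∣k with divides c k≡cq ← q∣k with euclidsLemma c q pb (subst (b ∣_) k≡cq b∣k)
      ... | inj₁ b∣c = <⇒≱ (<-trans (cofactor<y c k≡cq) y<b) (∣⇒≤ {{≢-nonZero (λ { refl → <-irrefl (sym k≡cq) 0<k })}} b∣c)
      ... | inj₂ b∣q with q-prime
      ...   | inj₁ refl = contradiction (subst Prime (∣1⇒≡1 b∣q) pb) ¬prime[1]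
      ...   | inj₂ pq   = <⇒≱ A<q (≤-trans (≤-reflexive (sym (prime∣prime⇒≡ pb pq b∣q))) b≤A)

    length-filter-split : ∀ {P : ℕ → Set} (P? : ∀ k → Dec (P k)) ks →
      length ks ≡ length (filter P? ks) + length (filter (¬? ∘ P?) ks)
    length-filter-split P? []       = refl
    length-filter-split P? (k ∷ ks) with P? k
    ... | yes _ = cong suc (length-filter-split P? ks)
    ... | no _  = trans (cong suc (length-filter-split P? ks)) (sym (+-suc _ _))

    -- The argument for siftedness needs `k` to be at least the square of `A₀`. The smaller `k` are
    -- counted trivially and fit into a second copy of the sieve error, whence the factor 2.
    rough-count : ∀ {N ks} → Unique ks → All (Rough K) ks → All (_≤ N) ks → suc N ≤ y₀ ^ suc K →
      length ks * (ρ * L ρ u 0<ρ 0<u) ≤ 896 * suc N + 2 * 2 ^ (12 * L ρ u 0<ρ 0<u) * (ρ * L ρ u 0<ρ 0<u)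
    rough-count {N} {ks} uks roughs ks≤N 1+N≤ = begin
      length ks * X                   ≡⟨ cong (_* X) (length-filter-split small? ks) ⟩
      (length smalls + length bigs) * X ≡⟨ *-distribʳ-+ X (length smalls) (length bigs) ⟩
      length smalls * X + length bigs * X ≤⟨ +-mono-≤ (*-monoˡ-≤ X few-smalls)
        (sifted-count ρ u 0<ρ 0<u (Unique.filter⁺ (¬? ∘ small?) uks)
          (All.tabulate (λ k∈ → s≤s (All.lookup ks≤N (proj₁ (∈-filter⁻ (¬? ∘ small?) {xs = ks} k∈)))))
          (All.tabulate (λ k∈ → let k∈ks , k≮ = ∈-filter⁻ (¬? ∘ small?) {xs = ks} k∈ in
            rough⇒sifted (All.lookup roughs k∈ks) (≮⇒≥ k≮) (≤-trans (s≤s (All.lookup ks≤N k∈ks)) 1+N≤)))) ⟩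
      Z * X + (896 * suc N + Z * X)   ≡⟨ regroup (Z * X) (896 * suc N) ⟩
      896 * suc N + 2 * (Z * X)       ≡⟨ cong (896 * suc N +_) (*-assoc 2 Z X) ⟨
      896 * suc N + 2 * Z * X         ∎
      where
      open ≤-Reasoning
      X Z L₀ : ℕ
      L₀ = L ρ u 0<ρ 0<u
      X = ρ * L₀
      Z = 2 ^ (12 * L₀)
      small? : ∀ k → Dec (k < A₀ * A₀)
      small? k = k <? A₀ * A₀
      smalls bigs : List ℕ
      smalls = filter small? ks
      bigs = filter (¬? ∘ small?) ks
      few-smalls : length smalls ≤ Z
      few-smalls = begin
        length smalls             ≤⟨ length-⊆ {ys = upTo (A₀ * A₀)} (Unique.filter⁺ small? uks)
                                       (λ k∈ → ∈-upTo⁺ (proj₂ (∈-filter⁻ small? {xs = ks} k∈))) ⟩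
        length (upTo (A₀ * A₀))   ≡⟨ length-upTo (A₀ * A₀) ⟩
        A₀ * A₀                   ≡⟨ ^-distribˡ-+-* 2 L₀ L₀ ⟨
        2 ^ (L₀ + L₀)             ≤⟨ ^-monoʳ-≤ 2 (≤-trans (≤-reflexive (n+n≡2*n L₀)) (*-monoˡ-≤ L₀ (m≤m+n 2 10))) ⟩
        Z                         ∎
      regroup : ∀ a b → a + (b + a) ≡ b + 2 * a
      regroup = solve-∀

  -- 1835008 = 2 · 4 · 896 · 256 collects the constants lost in the sieve bound and
  -- in Chebyshev's lower bound, and pays for the ratio 1/4.

  module _ (ρ : ℕ) (ρ-large : 1835008 ≤ ρ) where

    private
      -- `L` is `W * u`. With N between 2^j and 2^(j+1), the choice `u = j / d` gives `16 * L ≤ j`: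
      -- the sieve error A^12 stays below N with A^4 to spare.
      W d : ℕ
      W = 7 * 2 ^ ρ
      d = 16 * W

      instance
        2^ρ≢0 : NonZero (2 ^ ρ)
        2^ρ≢0 = m^n≢0 2 ρ
        d≢0 : NonZero d
        d≢0 = m*n≢0 16 W {{_}} {{m*n≢0 7 (2 ^ ρ)}}
        32*2^ρ≢0 : NonZero (32 * 2 ^ ρ)
        32*2^ρ≢0 = m*n≢0 32 (2 ^ ρ)

    -- `N + 1` is at most `2 ^ (32 * L)`, and this is `y` to the power `32 * 2 ^ ρ`, since `L` is
    -- `2 ^ ρ` times the exponent of `y`. So `K + 1 = 32 * 2 ^ ρ` makes every cofactor smaller than
    -- `y`.
    exponent : ℕ
    exponent = pred (32 * 2 ^ ρ)

    suc-exponent : suc exponent ≡ 32 * 2 ^ ρ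
    suc-exponent = suc-pred (32 * 2 ^ ρ)

    exponent>0 : 0 < exponent
    exponent>0 = s≤s⁻¹ (≤-trans (≤-trans (m≤m+n 2 30) (m≤m*n 32 (2 ^ ρ))) (≤-reflexive (sym suc-exponent)))

    -- From here on `d ≤ j`, so that `u = j / d` is positive.
    threshold : ℕ
    threshold = 2 ^ d

    -- Both terms of `rough-count`, multiplied by 8, are at most `π N * (ρ * L₀)`: the main term
    -- because `N + 1 ≤ 256 * L₀ * π N` and `ρ` absorbs the constants, the error because
    -- `16 * Z ≤ π N`. Cancelling 2 and `ρ * L₀` leaves the claim.
    few-rough : ∀ {N ks} → threshold ≤ N → Unique ks → All (Rough exponent) ks → All (_≤ N) ks → 4 * length ks ≤ π N
    few-rough {N} {ks} large uks roughs ks≤N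
      with j , 2^j≤N , N<2^1+j ← dyadic N (≤-trans (m^n>0 2 d) large) =
      *-cancelʳ-≤ (4 * length ks) (π N) X {{>-nonZero (*-mono-≤ 0<ρ L₀>0)}} (*-cancelˡ-≤ 2 (begin
        2 * (4 * length ks * X)                       ≡⟨ shuffle₁ (length ks) X ⟩
        8 * (length ks * X)                           ≤⟨ *-monoʳ-≤ 8
          (rough-count ρ u exponent 0<ρ 0<u exponent>0 uks roughs ks≤N 1+N≤y^) ⟩
        8 * (896 * suc N + 2 * Z * X)                 ≡⟨ shuffle₂ (suc N) Z X ⟩
        7168 * suc N + 16 * Z * X                     ≤⟨ +-mono-≤ (*-monoʳ-≤ 7168 1+N≤) (*-monoˡ-≤ X 16Z≤π) ⟩
        7168 * (256 * L₀ * π N) + π N * X             ≡⟨ cong (_+ π N * X) (shuffle₃ 7168 256 L₀ (π N)) ⟩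
        1835008 * (L₀ * π N) + π N * X                ≤⟨ +-monoˡ-≤ (π N * X) (*-monoˡ-≤ (L₀ * π N) ρ-large) ⟩
        ρ * (L₀ * π N) + π N * X                      ≡⟨ shuffle₄ ρ L₀ (π N) ⟩
        2 * (π N * X)                                 ∎))
      where
      open ≤-Reasoning
      0<ρ : 0 < ρ
      0<ρ = ≤-trans (m≤m+n 1 1835007) ρ-large
      d≤j : d ≤ j
      d≤j = s≤s⁻¹ (≰⇒> (λ 1+j≤d → <⇒≱ N<2^1+j (≤-trans (^-monoʳ-≤ 2 1+j≤d) large)))
      u : ℕ
      u = j / d
      0<u : 0 < u
      0<u = m≥n⇒m/n>0 d≤j
      L₀ X Z : ℕ
      L₀ = L ρ u 0<ρ 0<u
      X = ρ * L₀
      Z = 2 ^ (12 * L₀)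
      L₀>0 : 0 < L₀
      L₀>0 = L>0 ρ u 0<ρ 0<u
      16L≤j : 16 * L₀ ≤ j
      16L≤j = ≤-trans (≤-reflexive (shuffle (2 ^ ρ) u)) (m/n*n≤m j d)
        where
        shuffle : ∀ r u → 16 * (7 * (r * u)) ≡ u * (16 * (7 * r))
        shuffle = solve-∀
      -- As `u` is positive, the remainder of `j` is less than `d ≤ u * d`, and `2 * (u * d)` is
      -- `32 * L₀`.
      1+j≤32L : suc j ≤ 32 * L₀
      1+j≤32L = begin
        suc j                   ≡⟨ cong suc (m≡m%n+[m/n]*n j d) ⟩
        suc (j % d) + u * d     ≤⟨ +-monoˡ-≤ (u * d) (≤-trans (m%n<n j d) (m≤n*m d u {{>-nonZero 0<u}})) ⟩
        u * d + u * d           ≡⟨ shuffle (2 ^ ρ) u ⟩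
        32 * L₀                 ∎
        where
        shuffle : ∀ r u → u * (16 * (7 * r)) + u * (16 * (7 * r)) ≡ 32 * (7 * (r * u))
        shuffle = solve-∀
      1+N≤y^ : suc N ≤ y ρ u 0<ρ 0<u ^ suc exponent
      1+N≤y^ = begin
        suc N                       ≤⟨ N<2^1+j ⟩
        2 ^ suc j                   ≤⟨ ^-monoʳ-≤ 2 1+j≤32L ⟩
        2 ^ (32 * L₀)               ≡⟨ cong (2 ^_) (trans (shuffle (2 ^ ρ) u) (cong (7 * u *_) (sym suc-exponent))) ⟩
        2 ^ (7 * u * suc exponent)  ≡⟨ ^-*-assoc 2 (7 * u) (suc exponent) ⟨
        (2 ^ (7 * u)) ^ suc exponent ∎
        where
        shuffle : ∀ r u → 32 * (7 * (r * u)) ≡ 7 * u * (32 * r)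
        shuffle = solve-∀
      1+N≤ : suc N ≤ 256 * L₀ * π N
      1+N≤ = begin
        suc N                   ≤⟨ chebyshev {N} {j}
          (≤-trans (≤-trans (m≤m+n 2 14) (m≤m*n 16 L₀ {{>-nonZero L₀>0}})) 16L≤j) 2^j≤N N<2^1+j ⟩
        8 * (j * π N)           ≤⟨ *-monoʳ-≤ 8 (*-monoˡ-≤ (π N) (≤-trans (n≤1+n j) 1+j≤32L)) ⟩
        8 * (32 * L₀ * π N)     ≡⟨ shuffle L₀ (π N) ⟩
        256 * L₀ * π N          ∎
        where
        shuffle : ∀ l p → 8 * (32 * l * p) ≡ 256 * l * p
        shuffle = solve-∀
      -- Bounding `L₀` by `2 ^ L₀` in Chebyshev's estimate leaves powers of 2 only: 12 + 13 L₀ ≤ 16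
      -- L₀, which holds because `L₀` is at least 7.
      16Z≤π : 16 * Z ≤ π N
      16Z≤π = *-cancelʳ-≤ (16 * Z) (π N) (256 * 2 ^ L₀) {{m*n≢0 256 (2 ^ L₀) {{_}} {{m^n≢0 2 L₀}}}} (begin
        2 ^ 4 * 2 ^ (12 * L₀) * (2 ^ 8 * 2 ^ L₀) ≡⟨ cong₂ _*_ (^-distribˡ-+-* 2 4 (12 * L₀)) (^-distribˡ-+-* 2 8 L₀) ⟨
        2 ^ (4 + 12 * L₀) * 2 ^ (8 + L₀)  ≡⟨ ^-distribˡ-+-* 2 (4 + 12 * L₀) (8 + L₀) ⟨
        2 ^ (4 + 12 * L₀ + (8 + L₀))      ≤⟨ ^-monoʳ-≤ 2 exponents ⟩
        2 ^ (16 * L₀)                     ≤⟨ ^-monoʳ-≤ 2 16L≤j ⟩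
        2 ^ j                             ≤⟨ 2^j≤N ⟩
        N                                 ≤⟨ n≤1+n N ⟩
        suc N                             ≤⟨ 1+N≤ ⟩
        256 * L₀ * π N                    ≤⟨ *-monoˡ-≤ (π N) (*-monoʳ-≤ 256 (n≤2^n L₀)) ⟩
        256 * 2 ^ L₀ * π N                ≡⟨ *-comm (256 * 2 ^ L₀) (π N) ⟩
        π N * (256 * 2 ^ L₀)              ∎)
        where
        exponents : 4 + 12 * L₀ + (8 + L₀) ≤ 16 * L₀
        exponents = begin
          4 + 12 * L₀ + (8 + L₀)   ≡⟨ shuffle L₀ ⟩
          12 + 13 * L₀             ≤⟨ +-monoˡ-≤ (13 * L₀) (*-monoʳ-≤ 3
            (≤-trans (m≤m+n 4 3) (m≤m*n 7 (2 ^ ρ * u) {{>-nonZero (*-mono-≤ (m^n>0 2 ρ) 0<u)}}))) ⟩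
          3 * L₀ + 13 * L₀         ≡⟨ *-distribʳ-+ L₀ 3 13 ⟨
          16 * L₀                  ∎
          where
          shuffle : ∀ l → 4 + 12 * l + (8 + l) ≡ 12 + 13 * l
          shuffle = solve-∀
      shuffle₁ : ∀ n x → 2 * (4 * n * x) ≡ 8 * (n * x)
      shuffle₁ = solve-∀
      shuffle₂ : ∀ n z x → 8 * (896 * n + 2 * z * x) ≡ 7168 * n + 16 * z * x
      shuffle₂ = solve-∀
      shuffle₃ : ∀ a b l p → a * (b * l * p) ≡ a * b * (l * p)
      shuffle₃ = solve-∀
      shuffle₄ : ∀ ρ l p → ρ * (l * p) + p * (ρ * l) ≡ 2 * (p * (ρ * l))
      shuffle₄ = solve-∀

-- Passage from natural numbers to real `x`, real exponents and the limit superior.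

open import Data.Integer.Base using (+_)
open import Defs
import Data.Rational.Properties as ℚₚ
open import Data.Rational.Base as ℚ using (ℚ; mkℚ; _/_)
open import Data.Rational.Unnormalised.Base as ℚᵘ using (mkℚᵘ)
import Data.Rational.Unnormalised.Properties as ℚᵘₚ
open Sums using (i≤+∣i∣)
open Chebyshev using (primesIn-unique; ∈-primesIn⁻; length-⊆; prime>0; π)
open RoughPrimes using (Rough; few-rough; exponent; threshold)

open ℝ

foldr-⊔-∈ : ∀ ps → foldr ℕ._⊔_ 1 ps ≡ 1 ⊎ foldr ℕ._⊔_ 1 ps ∈ ps
foldr-⊔-∈ []       = inj₁ refl
foldr-⊔-∈ (p ∷ ps) with ℕₚ.⊔-sel p (foldr ℕ._⊔_ 1 ps)
... | inj₁ eq = inj₂ (here eq)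
... | inj₂ eq with foldr-⊔-∈ ps
...   | inj₁ ≡1   = inj₁ (trans eq ≡1)
...   | inj₂ ∈ps = inj₂ (there (subst (_∈ ps) (sym eq) ∈ps))

P⁺-factor : ∀ n → P⁺ n ≡ 1 ⊎ (Prime (P⁺ n) × P⁺ n ∣ n)
P⁺-factor zero = inj₁ refl
P⁺-factor n@(suc _) with foldr-⊔-∈ factors
  where open PrimeFactorisation (factorise n)
... | inj₁ ≡1 = inj₁ ≡1
... | inj₂ ∈factors = inj₂ (All.lookup factorsPrime ∈factors ,
  subst (P⁺ n ∣_) (sym isFactorisation) (∈⇒∣product ∈factors))
  where open PrimeFactorisation (factorise n)

P⁺-∣ : ∀ n → P⁺ n ∣ n
P⁺-∣ n with P⁺-factor n
... | inj₁ ≡1       = subst (_∣ n) (sym ≡1) (1∣ n)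
... | inj₂ (_ , P∣) = P∣

/-mono-< : ∀ a b c d .{{_ : NonZero b}} .{{_ : NonZero d}} → a ℕ.* d ℕ.< c ℕ.* b → + a / b ℚ.< + c / d
/-mono-< a (suc b) c (suc d) lt = ℚₚ.toℚᵘ-cancel-<
  (ℚᵘₚ.<-respˡ-≃ (ℚᵘₚ.≃-sym (ℚₚ.toℚᵘ-fromℚᵘ (mkℚᵘ (+ a) b)))
    (ℚᵘₚ.<-respʳ-≃ (ℚᵘₚ.≃-sym (ℚₚ.toℚᵘ-fromℚᵘ (mkℚᵘ (+ c) d)))
      (ℚᵘ.*<* (subst₂ ℤ._<_ (ℤₚ.pos-* a (suc d)) (ℤₚ.pos-* c (suc b)) (ℤ.+<+ lt)))))

/-mono-≤ : ∀ a b c d .{{_ : NonZero b}} .{{_ : NonZero d}} → a ℕ.* d ℕ.≤ c ℕ.* b → + a / b ℚ.≤ + c / d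
/-mono-≤ a (suc b) c (suc d) le = ℚₚ.toℚᵘ-cancel-≤
  (ℚᵘₚ.≤-respˡ-≃ (ℚᵘₚ.≃-sym (ℚₚ.toℚᵘ-fromℚᵘ (mkℚᵘ (+ a) b)))
    (ℚᵘₚ.≤-respʳ-≃ (ℚᵘₚ.≃-sym (ℚₚ.toℚᵘ-fromℚᵘ (mkℚᵘ (+ c) d)))
      (ℚᵘ.*≤* (subst₂ ℤ._≤_ (ℤₚ.pos-* a (suc d)) (ℤₚ.pos-* c (suc b)) (ℤ.+≤+ le)))))

/1-mono-< : ∀ m n → m ℕ.< n → + m / 1 ℚ.< + n / 1
/1-mono-< m n m<n = /-mono-< m 1 n 1 (ℕₚ.*-monoˡ-< 1 m<n)

/1-mono-≤ : ∀ m n → m ℕ.≤ n → + m / 1 ℚ.≤ + n / 1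
/1-mono-≤ m n m≤n = /-mono-≤ m 1 n 1 (ℕₚ.*-monoˡ-≤ 1 m≤n)

fromℚ-mono-< : ∀ {p q} → p ℚ.< q → fromℚ p < fromℚ q
fromℚ-mono-< = ℚₚ.<-dense

fromℚ-mono-≤ : ∀ {p q} → p ℚ.≤ q → fromℚ p ≤ fromℚ q
fromℚ-mono-≤ p≤q (r , q<r , r<p) = ℚₚ.<-irrefl refl (ℚₚ.<-≤-trans (ℚₚ.<-trans q<r r<p) p≤q)

archimedean : ∀ q → ∃[ n ] q ℚ.< + n / 1
archimedean q@(mkℚ num d-1 _) = suc ℤ.∣ num ∣ , subst (ℚ._< + suc ℤ.∣ num ∣ / 1) (ℚₚ.fromℚᵘ-toℚᵘ q)
  (ℚₚ.toℚᵘ-cancel-< (ℚᵘₚ.<-respˡ-≃ (ℚᵘₚ.≃-sym (ℚₚ.toℚᵘ-fromℚᵘ (mkℚᵘ num d-1)))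
    (ℚᵘₚ.<-respʳ-≃ (ℚᵘₚ.≃-sym (ℚₚ.toℚᵘ-fromℚᵘ (mkℚᵘ (+ suc ℤ.∣ num ∣) 0)))
      (ℚᵘ.*<* (bound num)))))
  where
  bound : ∀ i → i ℤ.* + 1 ℤ.< + suc ℤ.∣ i ∣ ℤ.* + suc d-1
  bound i = subst₂ ℤ._<_ (sym (ℤₚ.*-identityʳ i)) (ℤₚ.pos-* (suc ℤ.∣ i ∣) (suc d-1))
    (ℤₚ.≤-<-trans (i≤+∣i∣ i) (ℤ.+<+ (ℕₚ.m≤m*n (suc ℤ.∣ i ∣) (suc d-1))))

-- Locatedness only determines the integer part up to one unit.

approximate-floor : ∀ x {n₀} → fromℕ (2 ℕ.+ n₀) ≤ x →
                    ∃[ n ] (n₀ ℕ.≤ n × L x (+ n / 1) × U x (+ (2 ℕ.+ n) / 1))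
approximate-floor x {n₀} n₀≤x with q , Uq ← U-inhabited x with m , q<m ← archimedean q =
  search m (U-up x (ℚₚ.<-trans q<m (/1-mono-< m (suc m) (ℕₚ.n<1+n m))) Uq)
  where
  -- Descending search with invariant `x < m + 1`. Locating `x` with respect to two consecutive
  -- integers either lowers the bound by one or provides the integer below `x`; `n₀ ≤ m` follows
  -- from the lower bound on `x`.
  search : ∀ m → U x (+ suc m / 1) → ∃[ n ] (n₀ ℕ.≤ n × L x (+ n / 1) × U x (+ (2 ℕ.+ n) / 1))
  search zero    U1 = contradiction (+ 1 / 1 , U1 , /1-mono-< 1 (2 ℕ.+ n₀) (ℕ.s≤s (ℕ.s≤s ℕ.z≤n))) n₀≤x
  search (suc m) U2+m with located x (/1-mono-< m (suc m) (ℕₚ.n<1+n m))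
  ... | inj₂ U1+m = search m U1+m
  ... | inj₁ Lm   = m , ℕₚ.≮⇒≥ (λ m<n₀ → n₀≤x (+ (2 ℕ.+ m) / 1 , U2+m , /1-mono-< (2 ℕ.+ m) (2 ℕ.+ n₀) (ℕ.s≤s (ℕ.s≤s m<n₀)))) , Lm , U2+m

fromℕ≤⇒< : ∀ {x m n} → U x (+ n / 1) → fromℕ m ≤ x → m ℕ.< n
fromℕ≤⇒< {x} {m} {n} Un m≤x = ℕₚ.≰⇒> (λ n≤m → let q , q<n , Uq = U-open x Un in
  m≤x (q , Uq , ℚₚ.<-≤-trans q<n (/1-mono-≤ n m n≤m)))

≤⇒fromℕ≤ : ∀ {x m n} → L x (+ n / 1) → m ℕ.≤ n → fromℕ m ≤ x
≤⇒fromℕ≤ {x} {m} {n} Ln m≤n (q , Uq , q<m) = disjoint x (L-down x (ℚₚ.<-≤-trans q<m (/1-mono-≤ m n m≤n)) Ln) Uq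

predecessors : ∀ {ns} → All (0 ℕ.<_) ns → ∃[ ks ] ns ≡ map suc ks
predecessors [] = [] , refl
predecessors {suc n ∷ _} (_ ∷ 0<ns) with ks , refl ← predecessors 0<ns = n ∷ ks , refl

module _ (K N₀ : ℕ)
  (few-rough : ∀ {N ks} → N₀ ℕ.≤ N → Unique ks → All (Rough K) ks → All (ℕ._≤ N) ks → 4 ℕ.* length ks ℕ.≤ π N)
  where

  private
    K/[K+1]<1 : + K / suc K ℚ.< 1ℚ
    K/[K+1]<1 = /-mono-< K (suc K) 1 1 (ℕₚ.≤-reflexive (cong suc (trans (ℕₚ.*-identityʳ K) (sym (ℕₚ.+-identityʳ K)))))

  module _ {c : ℚ} (K/[K+1]<c : + K / suc K ℚ.< c) where

    rough : ∀ {k} → Prime (suc k) → suc k ^ fromℚ c ≤ℕ P⁺ k → Rough K k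
    rough {k} 1+k-prime large = record
      { 1+k-prime = 1+k-prime
      ; q         = P⁺ k
      ; q∣k       = P⁺-∣ k
      ; q-prime   = map₂ proj₁ (P⁺-factor k)
      ; large     = large K (suc K) (fromℚ-mono-< K/[K+1]<c)
      }

    -- The uncertainty in the integer part costs nothing. A prime `p ≤ x` is less than `N + 2`, so
    -- `k = p - 1` is at most `N`, as `few-rough` requires; and all primes up to `N` lie below `x`,
    -- so `π N` is at most π(x).
    4t≤π : ∀ {x N} → N₀ ℕ.≤ N → L x (+ N / 1) → U x (+ (2 ℕ.+ N) / 1) →
           ∀ {t n} → T[ fromℚ c , x ]≡ t → π[ x ]≡ n → t ℕ.* 4 ℕ.≤ 1 ℕ.* n
    4t≤π {x} {N} N₀≤N LN U2+N (ts , ts-unique , ts⇔ , refl) (ns , _ , ns⇔ , refl)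
      with ks , refl ← predecessors (All.tabulate {xs = ts} (λ {p} p∈ → prime>0 (proj₁ (Equivalence.to (ts⇔ p) p∈)))) = begin
      length (map suc ks) ℕ.* 4 ≡⟨ trans (cong (ℕ._* 4) (length-map suc ks)) (ℕₚ.*-comm (length ks) 4) ⟩
      4 ℕ.* length ks           ≤⟨ few-rough N₀≤N (Unique.map⁻ ts-unique)
        (All.tabulate (λ k∈ → let pp , _ , large = counted k∈ in rough pp large))
        (All.tabulate (λ k∈ → let _ , p≤x , _ = counted k∈ in ℕ.s≤s⁻¹ (ℕ.s≤s⁻¹ (fromℕ≤⇒< {x} {n = 2 ℕ.+ N} U2+N p≤x)))) ⟩
      π N                       ≤⟨ length-⊆ (primesIn-unique 0 N) (λ {p} p∈ → let pp , _ , p≤N = ∈-primesIn⁻ p∈ in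
        Equivalence.from (ns⇔ p) (pp , ≤⇒fromℕ≤ {x} {n = N} LN p≤N)) ⟩
      length ns                 ≡⟨ ℕₚ.+-identityʳ (length ns) ⟨
      1 ℕ.* length ns           ∎
      where
      open ℕₚ.≤-Reasoning
      counted : ∀ {k} → k ∈ ks → Prime (suc k) × fromℕ (suc k) ≤ x × suc k ^ fromℚ c ≤ℕ P⁺ k
      counted {k} k∈ = Equivalence.to (ts⇔ (suc k)) (∈-map⁺ suc k∈)

    ratio≤¼ : ∀ x → fromℕ (2 ℕ.+ N₀) ≤ x → ∀ y → T/π (fromℚ c) x y → fromℚ y ≤ fromℚ (+ 1 / 4)
    ratio≤¼ x X≤x y (t , n , T≡t , π≡n , n≢0 , refl) =
      let N , N₀≤N , LN , U2+N = approximate-floor x X≤x in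
      fromℚ-mono-≤ (/-mono-≤ t n 1 4 {{n≢0}} (4t≤π {x} N₀≤N LN U2+N T≡t π≡n))

  limsup<½ : ∃[ c ] (fromℚ 0ℚ < c × c < fromℚ 1ℚ × limsup (T/π c) < fromℚ ½)
  -- Any rational strictly between K/(K+1) and 1 serves as `c`: strictness makes K/(K+1) one of the
  -- exponents in the definition of `p ^ c ≤ℕ m`, which yields the field `large` of `Rough`.
  limsup<½ = let c , K/[K+1]<c , c<1 = ℚₚ.<-dense K/[K+1]<1 in
    fromℚ c , fromℚ-mono-< (ℚₚ.≤-<-trans (/-mono-≤ 0 1 K (suc K) ℕ.z≤n) K/[K+1]<c) , fromℚ-mono-< c<1 ,
    fromℚ (+ 1 / 4) , fromℚ-mono-< (/-mono-< 1 4 1 2 (ℕₚ.m<n+m 2 {2} (ℕ.s≤s ℕ.z≤n))) ,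
    fromℕ (2 ℕ.+ N₀) , ratio≤¼ K/[K+1]<c

-- Abstract because exponent and threshold contain 2 ^ 1835008.

abstract

  rough-primes-are-few : ∃[ K ] ∃[ N₀ ] (∀ {N ks} → N₀ ℕ.≤ N → Unique ks → All (Rough K) ks →
                         All (ℕ._≤ N) ks → 4 ℕ.* length ks ℕ.≤ π N)
  rough-primes-are-few = exponent 1835008 ℕₚ.≤-refl , threshold 1835008 ℕₚ.≤-refl , few-rough 1835008 ℕₚ.≤-refl

theorem1 : ∃[ c ] (fromℚ 0ℚ < c × c < fromℚ 1ℚ × limsup (T/π c) < fromℚ ½)
theorem1 = let K , N₀ , few = rough-primes-are-few in limsup<½ K N₀ few
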